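{- Let $p>3$ be a prime and let $d$ be an integer with $0\le d\le p-1$. If $d$ is odd, then $$\frac{1}{p}\sum_{k=0}^{p-1}\binom{k}{d}_2\equiv\frac{(-1)^{\frac{d+1}2}}{2}\bigg(\sum_{k=1}^{(d-1)/2}\frac{(-1)^k}{k}-3\sum_{\substack{1\le k\le (d-1)/2\\ 3\mid k+p}}\frac{(-1)^k}{k}\bigg)\pmod{p}.$$ If $d$ is even, then $$\frac{1}{p}\bigg((-1)^{\frac d2}\sum_{k=0}^{p-1}\binom{k}{d}_2-(-1)^{\frac{p-1}2}\bigg)\equiv 3\left(\frac{ -2}{p}\right)\frac{S_{(p-(\frac{3}{p}))/2}}{p}-2\sum_{0\le j<d/2}\frac{(-1)^j}{2j+1}+3\sum_{\substack{0\le j<d/2\\ 3\nmid p-2j-1}}\frac{(-1)^j}{2j+1}\pmod{p}.$$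
   Context: The trinomial coefficients $\binom{n}{k}_2$ are defined for integers $n\ge 0$ by $(1+x+x^{ -1})^n=\sum_{k=-n}^{n}\binom{n}{k}_2x^k$. The sequence $\{S_n\}$ is defined by $S_0=0$, $S_1=1$, $S_{n+1}=4S_n-S_{n-1}$ for $n\ge1$. $\left(\frac{\cdot}{p}\right)$ denotes the Legendre symbol. Congruences between rational numbers whose denominators are prime to $p$ are understood in the ring of rationals with denominator prime to $p$ (i.e. $a\equiv b \pmod p$ means $(a-b)/p$ has denominator prime to $p$). -}

module Defs where

open import Data.Nat as ℕ using (ℕ; zero; suc)
open import Data.Nat.Divisibility using (_∣_; _∣?_)
open import Data.Integer as ℤ using (ℤ; +_; -[1+_]; ∣_∣)
open import Data.Rational as ℚ using (ℚ; 0ℚ; 1ℚ; ↧ₙ_)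
open import Data.Bool using (Bool; true; false; if_then_else_)
open import Data.List using (List; upTo)
open import Data.Bool.ListAction using (any)
open import Relation.Nullary using (¬_)
open import Relation.Nullary.Decidable using (⌊_⌋)

-- trinomial coefficient  binom(n,k)_2 = coefficient of x^k in (1+x+x^{-1})^n
trinom : ℕ → ℤ → ℕ
trinom zero k = if ⌊ k ℤ.≟ + 0 ⌋ then 1 else 0
trinom (suc n) k = trinom n (k ℤ.- + 1) ℕ.+ trinom n k ℕ.+ trinom n (k ℤ.+ + 1)

S : ℕ → ℤ
S zero = + 0
S (suc zero) = + 1
S (suc (suc n)) = + 4 ℤ.* S (suc n) ℤ.- S n

legendre : ℤ → ℕ → ℤ
legendre a p =
  if ⌊ p ∣? ∣ a ∣ ⌋ then + 0
  else if any (λ x → ⌊ p ∣? ∣ (+ x) ℤ.* (+ x) ℤ.- a ∣ ⌋) (upTo p) then + 1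
  else ℤ.- (+ 1)

-- the rational number 1/n (only ever applied to n ≥ 1; 1/0 := 0 is a dummy)
recip : ℕ → ℚ
recip zero = 0ℚ
recip (suc n) = + 1 ℚ./ suc n

sgn : ℕ → ℚ
sgn zero = 1ℚ
sgn (suc k) = ℚ.- sgn k

sumRange : ℕ → ℕ → (ℕ → ℚ) → ℚ
sumRange a b f = go (suc b ℕ.∸ a)
  where
  go : ℕ → ℚ
  go zero = 0ℚ
  go (suc n) = go n ℚ.+ f (a ℕ.+ n)

-- a ≡ b (mod p) for rationals: (a - b)/p has denominator prime to p
-- (for p prime, "prime to p" = "not divisible by p")
_≡_[modℚ_] : ℚ → ℚ → ℕ → Set
a ≡ b [modℚ p ] = ¬ (p ∣ ↧ₙ ((a ℚ.- b) ℚ.* recip p))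

sumBelow : ℕ → (ℕ → ℚ) → ℚ
sumBelow zero f = 0ℚ
sumBelow (suc n) f = sumBelow n f ℚ.+ f n

{-# OPTIONS --safe #-}
module Submission where

open import Defs
open import Data.Nat as ℕ using (ℕ; zero; suc; _<_; _∸_; s≤s; z≤n)
open import Data.Nat.DivMod using (m*n/n≡m)
open import Data.Nat.Primality using (Prime; euclidsLemma; prime⇒nonZero; prime⇒irreducible; ¬prime[1])
open import Data.Nat.Divisibility using (_∣?_)
import Data.Nat.Divisibility as ℕ∣
import Data.Nat.Properties as ℕₚ
open import Data.Integer as ℤ using (ℤ; +_; -[1+_]; ∣_∣; _+_; _*_; _-_; -_; _^_)
open import Data.Integer.Divisibility.Signed using (_∣_; divides; ∣ᵤ⇒∣; ∣⇒∣ᵤ; ∣m∣n⇒∣m+n; ∣n⇒∣m*n; ∣m⇒∣m*n)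
import Data.Integer.Properties as ℤₚ
open import Data.Integer.Tactic.RingSolver using (solve-∀)
open import Data.Rational as ℚ using (ℚ; 0ℚ; 1ℚ; _/_; ↧ₙ_; toℚᵘ)
import Data.Rational.Properties as ℚₚ
open import Data.Rational.Solver using (module +-*-Solver)
open +-*-Solver using (solve; _:=_; _:+_; _:*_; _:-_; :-_; con)
import Data.Rational.Unnormalised as ℚᵘ
import Data.Rational.Unnormalised.Properties as ℚᵘₚ
open import Data.Bool using (if_then_else_; not; true; false) renaming (T to IsTrue)
open import Data.Bool.ListAction using (any)
open import Data.Empty using (⊥-elim)
open import Data.List using (upTo)
open import Data.List.Membership.Propositional using (lose)
open import Data.List.Membership.Propositional.Properties using (∈-upTo⁺)
open import Data.List.Relation.Unary.Any using (satisfied)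
open import Data.List.Relation.Unary.Any.Properties using (any⁺; any⁻)
open import Data.Product using (_×_; _,_; ∃; proj₁; proj₂)
open import Data.Sum using (_⊎_; inj₁; inj₂; [_,_]′)
open import Relation.Binary.PropositionalEquality using (_≡_; refl; sym; trans; cong; cong₂; subst; subst₂; module ≡-Reasoning)
open import Relation.Nullary using (¬_; yes; no)
open import Relation.Nullary.Decidable using (⌊_⌋; toWitness; fromWitness)

-- Write t n d for the coefficient of x^d in (1+x+1/x)^n, T d for the sum of t k d over k < p, and
-- h = (p-1)/2. As (1+x+1/x) - 1 = x + 1/x, one has T (d-1) + T (d+1) = t p d for d ≥ 1, with T p = 0 and T (p-1) = 1.
-- Differentiating (1+x+1/x)^p gives t p d / p ≡ w(p-d) / d (mod p), where w(j) = ωʲ + ω⁻ʲ for a cube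
-- root of unity ω, which reduces the theorem to T 0 and T 1 modulo p². Comparing with binomial
-- coefficients, t p d ≡ ± w(p-d) C(p,d) (mod p²), so that T 0 and T 1 are determined by the imaginary
-- and real parts Y and X of Σₖ C(p,k) iᵏ w(p-k) = (ω+i)^p + (ω⁻¹+i)^p. As (ω+i)² = iω(2+√3), X and Y are
-- explicit in (2+√3)^h = u h + S h √3. They are known modulo p because p ∣ C(p,k); the same
-- congruence for (1+√3)^p, together with Euler's criterion, identifies the Legendre symbols of 3 and -2,
-- and the Pell equation u² - 3S² = 1 lifts u ≡ ±1 from modulo p to modulo p².

-- Divisibility

-- The statement divides by p and then asks for a congruence modulo p, so T 0 and T 1 are needed
-- modulo p², one order more than the divisibility p ∣ C(p,k) yields for X and Y. The missing order
-- comes from the conic u² - 3S² = 1: near the point (1,0) the first coordinate is stationary, so it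
-- is fixed to second order, while S is known only modulo p and therefore survives in the answer.
-- The point near (±1,0) is the power h of 2+√3 if (3/p) = 1 and the power h+1 if (3/p) = -1, whence
-- the index (p-(3/p))/2. In the coefficient of S, the factor 2^h comes from (1+√3)² = 2(2+√3) and
-- the factor (-1)^h from the powers of i; together they are (-2)^h. All computation stays in ℤ: i,
-- ω and √3 enter only through integer component sequences. The exponent p-k of ω is written p+2k,
-- which agrees with it modulo 3, needs no subtraction and turns a shift of k into a step of 2.

∣-combination : ∀ {m x y z} (a b : ℤ) → m ∣ x → m ∣ y → z ≡ a * x + b * y → m ∣ z
∣-combination a b m∣x m∣y refl = ∣m∣n⇒∣m+n (∣n⇒∣m*n a m∣x) (∣n⇒∣m*n b m∣y)

∣-multiple : ∀ {m x z} (a : ℤ) → m ∣ x → z ≡ a * x → m ∣ z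
∣-multiple a m∣x refl = ∣n⇒∣m*n a m∣x

∣0 : ∀ {m} → m ∣ + 0
∣0 = divides (+ 0) refl

∣-cong : ∀ {m x y} → x ≡ y → m ∣ x → m ∣ y
∣-cong refl m∣x = m∣x

∣-transfer : ∀ {m x y} → m ∣ x - y → m ∣ y → m ∣ x
∣-transfer {x = x} {y} m∣x-y m∣y = ∣-combination (+ 1) (+ 1) m∣x-y m∣y (identity x y)
  where
  identity : ∀ x y → x ≡ + 1 * (x - y) + + 1 * y
  identity = solve-∀

euclidℤ : ∀ {p} → Prime p → ∀ x y → + p ∣ x * y → (+ p ∣ x) ⊎ (+ p ∣ y)
euclidℤ {p} pp x y p∣xy with euclidsLemma ∣ x ∣ ∣ y ∣ pp (subst (p ℕ∣.∣_) (ℤₚ.abs-* x y) (∣⇒∣ᵤ p∣xy))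
... | inj₁ p∣x = inj₁ (∣ᵤ⇒∣ p∣x)
... | inj₂ p∣y = inj₂ (∣ᵤ⇒∣ p∣y)

∤-small : ∀ {p k} → suc k < p → ¬ + p ∣ + suc k
∤-small k<p p∣k = ℕₚ.<⇒≱ k<p (ℕ∣.∣⇒≤ (∣⇒∣ᵤ p∣k))

cancel-coprime : ∀ {p} → Prime p → ∀ {k} → ¬ + p ∣ k → ∀ {x} → + p ∣ k * x → + p ∣ x
cancel-coprime pp {k} p∤k {x} p∣kx with euclidℤ pp k x p∣kx
... | inj₁ p∣k = ⊥-elim (p∤k p∣k)
... | inj₂ p∣x = p∣x

-- Euclid's lemma removes one factor p at a time: it gives x = y p, and after cancelling p the
-- product k y is again a multiple of p.
cancel-coprime² : ∀ {p} → Prime p → ∀ {k} → ¬ + p ∣ k → ∀ {x} → + p * + p ∣ k * x → + p * + p ∣ x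
cancel-coprime² {p} pp {k} p∤k {x} (divides q kx≡qpp) with cancel-coprime pp p∤k {x} (divides (q * + p) (trans kx≡qpp (sym (ℤₚ.*-assoc q (+ p) (+ p)))))
... | divides y refl with cancel-coprime pp p∤k {y} (divides q (ℤₚ.*-cancelʳ-≡ (k * y) (q * + p) (+ p) {{prime⇒nonZero pp}} (trans (ℤₚ.*-assoc k y (+ p)) (trans kx≡qpp (sym (ℤₚ.*-assoc q (+ p) (+ p)))))))
... | divides z refl = divides z (ℤₚ.*-assoc z (+ p) (+ p))

-- Finite sums

sum : ℕ → (ℕ → ℤ) → ℤ
sum zero f = + 0
sum (suc n) f = sum n f + f n

sum-cong : ∀ {f g} n → (∀ k → f k ≡ g k) → sum n f ≡ sum n g
sum-cong zero f≗g = refl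
sum-cong (suc n) f≗g = cong₂ _+_ (sum-cong n f≗g) (f≗g n)

sum-+ : ∀ n f g → sum n (λ k → f k + g k) ≡ sum n f + sum n g
sum-+ zero f g = refl
sum-+ (suc n) f g = trans (cong (_+ (f n + g n)) (sum-+ n f g)) (interchange (sum n f) (sum n g) (f n) (g n))
  where
  interchange : ∀ a b c d → a + b + (c + d) ≡ a + c + (b + d)
  interchange = solve-∀

sum-head : ∀ n f → sum (suc n) f ≡ f 0 + sum n (λ k → f (suc k))
sum-head zero f = ℤₚ.+-comm (+ 0) (f 0)
sum-head (suc n) f = trans (cong (_+ f (suc n)) (sum-head n f)) (ℤₚ.+-assoc (f 0) (sum n (λ k → f (suc k))) (f (suc n)))

sum-∣ : ∀ {m f} n → (∀ k → k < n → m ∣ f k) → m ∣ sum n f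
sum-∣ zero m∣f = ∣0
sum-∣ (suc n) m∣f = ∣m∣n⇒∣m+n (sum-∣ n (λ k k<n → m∣f k (ℕₚ.m<n⇒m<1+n k<n))) (m∣f n ℕₚ.≤-refl)

-- Binomial coefficients and the binomial transform

binom : ℕ → ℕ → ℤ
binom n zero = + 1
binom zero (suc k) = + 0
binom (suc n) (suc k) = binom n k + binom n (suc k)

binom-vanishes : ∀ {n k} → n < k → binom n k ≡ + 0
binom-vanishes {zero} (s≤s _) = refl
binom-vanishes {suc n} (s≤s n<k) = cong₂ _+_ (binom-vanishes n<k) (binom-vanishes (ℕₚ.m<n⇒m<1+n n<k))

binom-diagonal : ∀ n → binom n n ≡ + 1
binom-diagonal zero = refl
binom-diagonal (suc n) = cong₂ _+_ (binom-diagonal n) (binom-vanishes (ℕₚ.n<1+n n))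

-- The integral form of C(n+1,k+1) = (n+1)/(k+1) C(n,k). It parallels `t-derivative`, and the
-- comparison of t p with C(p,k) rests on this likeness.
binom-absorption : ∀ n k → + suc k * binom (suc n) (suc k) ≡ + suc n * binom n k
binom-absorption zero zero = refl
binom-absorption zero (suc k) = ℤₚ.*-zeroʳ (+ suc (suc k))
binom-absorption (suc n) zero = step (+ suc n) (binom (suc n) 1) (binom-absorption n zero)
  where
  identity : ∀ B → + 1 * (+ 1 + B) ≡ + 1 + + 1 * B
  identity = solve-∀
  step : ∀ N B → + 1 * B ≡ N * + 1 → + 1 * (+ 1 + B) ≡ (+ 1 + N) * + 1
  step N B eq = trans (identity B) (trans (cong (λ x → + 1 + x) eq) (sym (ℤₚ.*-distribʳ-+ (+ 1) (+ 1) N)))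
binom-absorption (suc n) (suc k) = begin
  (+ 1 + K) * (B₁ + B₂)             ≡⟨ identity₁ K B₁ B₂ ⟩
  K * B₁ + (+ 1 + K) * B₂ + B₁      ≡⟨ cong₂ (λ x y → x + y + B₁) (binom-absorption n k) (binom-absorption n (suc k)) ⟩
  N * binom n k + N * binom n (suc k) + B₁  ≡⟨ identity₂ N (binom n k) (binom n (suc k)) ⟩
  (+ 1 + N) * B₁                    ∎
  where
  open ≡-Reasoning
  K = + suc k
  N = + suc n
  B₁ = binom (suc n) (suc k)
  B₂ = binom (suc n) (suc (suc k))
  identity₁ : ∀ K x y → (+ 1 + K) * (x + y) ≡ K * x + (+ 1 + K) * y + x
  identity₁ = solve-∀
  identity₂ : ∀ N x y → N * x + N * y + (x + y) ≡ (+ 1 + N) * (x + y)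
  identity₂ = solve-∀

-- Σₖ C(n,k) f(k)
W : (ℕ → ℤ) → ℕ → ℤ
W f zero = f 0
W f (suc n) = W f n + W (λ k → f (suc k)) n

W-sum : ∀ f n → W f n ≡ sum (suc n) (λ k → binom n k * f k)
W-sum f zero = identity (f 0)
  where
  identity : ∀ x → x ≡ + 0 + + 1 * x
  identity = solve-∀
W-sum f (suc n) = sym (begin
  sum (suc (suc n)) (λ k → binom (suc n) k * f k)
    ≡⟨ sum-head (suc n) _ ⟩
  F₀ + sum (suc n) (λ k → (binom n k + binom n (suc k)) * f (suc k))
    ≡⟨ cong (λ x → F₀ + x) (trans (sum-cong (suc n) (λ k → ℤₚ.*-distribʳ-+ (f (suc k)) (binom n k) (binom n (suc k)))) (sum-+ (suc n) _ _)) ⟩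
  F₀ + (shifted + (sum n (λ k → binom n (suc k) * f (suc k)) + binom n (suc n) * f (suc n)))
    ≡⟨ cong (λ x → F₀ + (shifted + (sum n (λ k → binom n (suc k) * f (suc k)) + x * f (suc n)))) (binom-vanishes (ℕₚ.n<1+n n)) ⟩
  F₀ + (shifted + (sum n (λ k → binom n (suc k) * f (suc k)) + + 0 * f (suc n)))
    ≡⟨ identity F₀ shifted _ (f (suc n)) ⟩
  F₀ + sum n (λ k → binom n (suc k) * f (suc k)) + shifted
    ≡⟨ cong (_+ shifted) (sym (sum-head n (λ k → binom n k * f k))) ⟩
  sum (suc n) (λ k → binom n k * f k) + shifted
    ≡⟨ sym (cong₂ _+_ (W-sum f n) (W-sum (λ k → f (suc k)) n)) ⟩
  W f n + W (λ k → f (suc k)) n ∎)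
  where
  open ≡-Reasoning
  F₀ = + 1 * f 0
  shifted = sum (suc n) (λ k → binom n k * f (suc k))
  identity : ∀ a c d e → a + (c + (d + + 0 * e)) ≡ a + d + c
  identity = solve-∀

W-cong : ∀ {f g} n → (∀ k → f k ≡ g k) → W f n ≡ W g n
W-cong zero f≗g = f≗g 0
W-cong (suc n) f≗g = cong₂ _+_ (W-cong n f≗g) (W-cong n (λ k → f≗g (suc k)))

W-scale : ∀ a f n → W (λ k → a * f k) n ≡ a * W f n
W-scale a f zero = refl
W-scale a f (suc n) = trans (cong₂ _+_ (W-scale a f n) (W-scale a (λ k → f (suc k)) n)) (sym (ℤₚ.*-distribˡ-+ a _ _))

-- Trinomial coefficients

t : ℕ → ℤ → ℤ
t n k = + trinom n k

t-zero : ∀ k → k * t 0 k ≡ + 0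
t-zero k with k ℤ.≟ + 0
... | yes refl = refl
... | no _ = ℤₚ.*-zeroʳ k

-- The coefficient form of x·d/dx (1 + x + 1/x)^(n+1) = (n+1)(x - 1/x)(1 + x + 1/x)^n.
t-derivative : ∀ n d → d * t (suc n) d ≡ + suc n * (t n (d - + 1) - t n (d + + 1))
t-derivative zero d = begin
  d * (x + y + z)
    ≡⟨ identity d x y z ⟩
  (d - + 1) * x + d * y + (d + + 1) * z + + 1 * (x - z)
    ≡⟨ cong (_+ + 1 * (x - z)) (cong₂ _+_ (cong₂ _+_ (t-zero (d - + 1)) (t-zero d)) (t-zero (d + + 1))) ⟩
  + 0 + + 1 * (x - z)
    ≡⟨ ℤₚ.+-identityˡ _ ⟩
  + 1 * (x - z) ∎
  where
  open ≡-Reasoning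
  x = t 0 (d - + 1)
  y = t 0 d
  z = t 0 (d + + 1)
  identity : ∀ d x y z → d * (x + y + z) ≡ (d - + 1) * x + d * y + (d + + 1) * z + + 1 * (x - z)
  identity = solve-∀
t-derivative (suc n) d = begin
  d * (T₁ + T₂ + T₃)
    ≡⟨ identity₁ d T₁ T₂ T₃ ⟩
  (d - + 1) * T₁ + d * T₂ + (d + + 1) * T₃ + (T₁ - T₃)
    ≡⟨ cong (_+ (T₁ - T₃)) (cong₂ _+_ (cong₂ _+_ (t-derivative n (d - + 1)) (t-derivative n d)) (t-derivative n (d + + 1))) ⟩
  N * (t n (d - + 1 - + 1) - t n (d - + 1 + + 1)) + N * (t n (d - + 1) - t n (d + + 1)) + N * (t n (d + + 1 - + 1) - t n (d + + 1 + + 1)) + (T₁ - T₃)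
    ≡⟨ combine (t n (d - + 1 - + 1)) (t n (d - + 1)) (cong (t n) (down-up d)) (cong (t n) (up-down d)) (t n (d + + 1)) (t n (d + + 1 + + 1)) ⟩
  (+ 1 + N) * (T₁ - T₃) ∎
  where
  open ≡-Reasoning
  N = + suc n
  T₁ = t (suc n) (d - + 1)
  T₂ = t (suc n) d
  T₃ = t (suc n) (d + + 1)
  down-up : ∀ d → d - + 1 + + 1 ≡ d
  down-up = solve-∀
  up-down : ∀ d → d + + 1 - + 1 ≡ d
  up-down = solve-∀
  identity₁ : ∀ d x y z → d * (x + y + z) ≡ (d - + 1) * x + d * y + (d + + 1) * z + (x - z)
  identity₁ = solve-∀
  identity₂ : ∀ N A B C D E → N * (A - C) + N * (B - D) + N * (C - E) + (A + B + C - (C + D + E)) ≡ (+ 1 + N) * (A + B + C - (C + D + E))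
  identity₂ = solve-∀
  combine : ∀ A B {C C₁ C₂} → C₁ ≡ C → C₂ ≡ C → ∀ D E → N * (A - C₁) + N * (B - D) + N * (C₂ - E) + (A + B + C₁ - (C₂ + D + E)) ≡ (+ 1 + N) * (A + B + C₁ - (C₂ + D + E))
  combine A B {C} refl refl D E = identity₂ N A B C D E

suc-+1 : ∀ k → + suc k + + 1 ≡ + suc (suc k)
suc-+1 k = cong +_ (ℕₚ.+-comm (suc k) 1)

t-suc : ∀ n k → t (suc n) (+ suc k) ≡ t n (+ k) + t n (+ suc k) + t n (+ suc (suc k))
t-suc n k = cong (λ x → t n (+ k) + t n (+ suc k) + t n x) (suc-+1 k)

t-vanishes : ∀ {n k} → n < k → t n (+ k) ≡ + 0
t-vanishes {zero} {suc k} _ = refl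
t-vanishes {suc n} {suc k} (s≤s n<k) = trans (t-suc n k)
  (cong₂ _+_ (cong₂ _+_ (t-vanishes n<k) (t-vanishes (ℕₚ.m<n⇒m<1+n n<k))) (t-vanishes (ℕₚ.m<n⇒m<1+n (ℕₚ.m<n⇒m<1+n n<k))))

t-diagonal : ∀ n → t n (+ n) ≡ + 1
t-diagonal zero = refl
t-diagonal (suc n) = trans (t-suc n n)
  (cong₂ _+_ (cong₂ _+_ (t-diagonal n) (t-vanishes (ℕₚ.n<1+n n))) (t-vanishes (ℕₚ.m<n⇒m<1+n (ℕₚ.n<1+n n))))

T : ℕ → ℕ → ℤ
T N d = sum N (λ k → t k (+ d))

-- The geometric series gives (1+x+1/x)^N - 1; the term -1 sits at exponent 0 and is not seen at d +
-- 1.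
T-recurrence : ∀ N d → T N d + T N (suc (suc d)) ≡ t N (+ suc d)
T-recurrence zero d = refl
T-recurrence (suc N) d = begin
  T N d + t N (+ d) + (T N (suc (suc d)) + t N (+ suc (suc d)))
    ≡⟨ identity (T N d) (t N (+ d)) (T N (suc (suc d))) _ ⟩
  T N d + T N (suc (suc d)) + t N (+ d) + t N (+ suc (suc d))
    ≡⟨ cong (λ x → x + t N (+ d) + t N (+ suc (suc d))) (T-recurrence N d) ⟩
  t N (+ suc d) + t N (+ d) + t N (+ suc (suc d))
    ≡⟨ cong (_+ t N (+ suc (suc d))) (ℤₚ.+-comm (t N (+ suc d)) (t N (+ d))) ⟩
  t N (+ d) + t N (+ suc d) + t N (+ suc (suc d))
    ≡⟨ sym (t-suc N d) ⟩
  t (suc N) (+ suc d) ∎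
  where
  open ≡-Reasoning
  identity : ∀ a c d e → a + c + (d + e) ≡ a + d + c + e
  identity = solve-∀

T-vanishes : ∀ {N d} → N ℕ.≤ d → T N d ≡ + 0
T-vanishes {zero} _ = refl
T-vanishes {suc N} N<d = cong₂ _+_ (T-vanishes (ℕₚ.<⇒≤ N<d)) (t-vanishes N<d)

T-diagonal : ∀ N → T (suc N) N ≡ + 1
T-diagonal N = cong₂ _+_ (T-vanishes {N} ℕₚ.≤-refl) (t-diagonal N)

-- The summand is Φₖ₊₁ - Φₖ for Φₖ = e(k) T(k+1) - e(k+1) T(k).
T-telescope : ∀ N n (e : ℕ → ℤ) → (∀ k → e (suc (suc k)) ≡ - e k) →
  sum n (λ k → e (suc k) * t N (+ suc k)) ≡ (e n * T N (suc n) - e (suc n) * T N n) - (e 0 * T N 1 - e 1 * T N 0)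
T-telescope N zero e anti = sym (ℤₚ.+-inverseʳ (e 0 * T N 1 - e 1 * T N 0))
T-telescope N (suc n) e anti = begin
  sum n (λ k → e (suc k) * t N (+ suc k)) + e (suc n) * t N (+ suc n)
    ≡⟨ cong₂ _+_ (T-telescope N n e anti) (cong (e (suc n) *_) (sym (T-recurrence N n))) ⟩
  (e n * T N (suc n) - e (suc n) * T N n) - Φ₀ + e (suc n) * (T N n + T N (suc (suc n)))
    ≡⟨ identity (e n) (e (suc n)) (T N n) (T N (suc n)) (T N (suc (suc n))) Φ₀ ⟩
  (e (suc n) * T N (suc (suc n)) - - e n * T N (suc n)) - Φ₀
    ≡⟨ cong (λ x → (e (suc n) * T N (suc (suc n)) - x * T N (suc n)) - Φ₀) (sym (anti n)) ⟩
  (e (suc n) * T N (suc (suc n)) - e (suc (suc n)) * T N (suc n)) - Φ₀ ∎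
  where
  open ≡-Reasoning
  Φ₀ = e 0 * T N 1 - e 1 * T N 0
  identity : ∀ e₀ e₁ T₀ T₁ T₂ Φ → (e₀ * T₁ - e₁ * T₀) - Φ + e₁ * (T₀ + T₂) ≡ (e₁ * T₂ - - e₀ * T₁) - Φ
  identity = solve-∀

-- Periodic sequences

-- m + 2k, arranged so that dbl m (suc k) computes
dbl : ℕ → ℕ → ℕ
dbl m zero = m
dbl m (suc k) = suc (suc (dbl m k))

dbl-suc : ∀ m k → dbl (suc m) k ≡ suc (dbl m k)
dbl-suc m zero = refl
dbl-suc m (suc k) = cong (λ x → suc (suc x)) (dbl-suc m k)

-- ωʲ + ω⁻ʲ for a primitive cube root of unity ω
w : ℕ → ℤ
w 0 = + 2
w 1 = - + 1
w 2 = - + 1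
w (suc (suc (suc j))) = w j

-- (ωʲ - ω⁻ʲ) / √-3
χ : ℕ → ℤ
χ 0 = + 0
χ 1 = + 1
χ 2 = - + 1
χ (suc (suc (suc j))) = χ j

χ-recurrence : ∀ j → χ (suc (suc j)) ≡ - χ (suc j) - χ j
χ-recurrence 0 = refl
χ-recurrence 1 = refl
χ-recurrence 2 = refl
χ-recurrence (suc (suc (suc j))) = χ-recurrence j

χ-difference : ∀ j → χ (suc (suc j)) - χ j ≡ w (suc j)
χ-difference 0 = refl
χ-difference 1 = refl
χ-difference 2 = refl
χ-difference (suc (suc (suc j))) = χ-difference j

-- Two steps of 2 in the exponent lead from j to j+4, and `w (j+4)` is `w (suc j)` by periodicity.
-- The factor is -(ω² - ω⁻²) times √-3, that is -3.
w-difference₄ : ∀ j → w j - w (suc j) ≡ - + 3 * χ (suc (suc j))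
w-difference₄ 0 = refl
w-difference₄ 1 = refl
w-difference₄ 2 = refl
w-difference₄ (suc (suc (suc j))) = w-difference₄ j

χ-difference₄ : ∀ j → χ j - χ (suc j) ≡ w (suc (suc j))
χ-difference₄ 0 = refl
χ-difference₄ 1 = refl
χ-difference₄ 2 = refl
χ-difference₄ (suc (suc (suc j))) = χ-difference₄ j

-- For i + k = p this identifies w at p + 2k with w at p - k.
w-dbl : ∀ i k → w (dbl (i ℕ.+ k) k) ≡ w i
w-dbl i zero = cong w (ℕₚ.+-identityʳ i)
w-dbl i (suc k) = trans (cong (λ x → w (suc (suc x))) (trans (cong (λ x → dbl x k) (ℕₚ.+-suc i k)) (dbl-suc (i ℕ.+ k) k))) (w-dbl i k)

-- 1 + 4h ≡ 1 + h (mod 3)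
periodic-1+4h : ∀ (f : ℕ → ℤ) → (∀ k → f (suc (suc (suc k))) ≡ f k) → ∀ h → f (dbl (suc (dbl 0 h)) h) ≡ f (suc h)
periodic-1+4h f per zero = refl
periodic-1+4h f per (suc h) = trans (cong (λ x → f (suc (suc x))) (trans (dbl-suc (suc (suc (dbl 0 h))) h) (cong suc (dbl-suc (suc (dbl 0 h)) h))))
  (trans (per (suc (dbl (suc (dbl 0 h)) h))) (periodic-1+4h (λ k → f (suc k)) (λ k → per (suc k)) h))

-- real and imaginary parts of iᵏ
co si : ℕ → ℤ
co zero = + 1
co (suc k) = - si k
si zero = + 0
si (suc k) = co k

sg : ℕ → ℤ
sg zero = + 1
sg (suc k) = - sg k

-- Real parts of iᵏ live on even k and imaginary parts on odd k. Hence the alternating sign between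
-- t p d and C(p,d) is absorbed by the weights.
sg-parity : ∀ k → sg k * co k ≡ co k × sg k * si k ≡ - si k
sg-parity zero = refl , refl
sg-parity (suc k) with sg-parity k
... | even , odd = trans (neg-neg (sg k) (si k)) odd , trans (neg (sg k) (co k)) (cong -_ even)
  where
  neg-neg : ∀ x y → - x * - y ≡ x * y
  neg-neg = solve-∀
  neg : ∀ x y → - x * y ≡ - (x * y)
  neg = solve-∀

si-dbl : ∀ n → si (dbl 0 n) ≡ + 0
si-dbl zero = refl
si-dbl (suc n) = cong -_ (si-dbl n)

co-dbl : ∀ n → co (dbl 0 n) ≡ sg n
co-dbl zero = refl
co-dbl (suc n) = cong -_ (co-dbl n)

-- The Pell sequence: (2 + √3)ˡ = u l + S l √3

u : ℕ → ℤ
u l = S (suc l) - + 2 * S l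

S-suc : ∀ l → S (suc l) ≡ u l + + 2 * S l
S-suc l = identity (S (suc l)) (S l)
  where
  identity : ∀ x y → x ≡ x - + 2 * y + + 2 * y
  identity = solve-∀

u-suc : ∀ l → u (suc l) ≡ + 2 * u l + + 3 * S l
u-suc l = identity (S (suc l)) (S l)
  where
  identity : ∀ x y → + 4 * x - y - + 2 * x ≡ + 2 * (x - + 2 * y) + + 3 * y
  identity = solve-∀

pell : ∀ l → u l * u l ≡ + 1 + + 3 * (S l * S l)
pell zero = refl
pell (suc l) = begin
  u (suc l) * u (suc l)
    ≡⟨ cong (λ x → x * x) (u-suc l) ⟩
  (+ 2 * u l + + 3 * S l) * (+ 2 * u l + + 3 * S l)
    ≡⟨ identity₁ (u l) (S l) ⟩
  u l * u l + (+ 3 * (u l * u l) + + 12 * u l * S l + + 9 * (S l * S l))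
    ≡⟨ cong (_+ (+ 3 * (u l * u l) + + 12 * u l * S l + + 9 * (S l * S l))) (pell l) ⟩
  + 1 + + 3 * (S l * S l) + (+ 3 * (u l * u l) + + 12 * u l * S l + + 9 * (S l * S l))
    ≡⟨ identity₂ (u l) (S l) ⟩
  + 1 + + 3 * ((u l + + 2 * S l) * (u l + + 2 * S l))
    ≡⟨ cong (λ x → + 1 + + 3 * (x * x)) (sym (S-suc l)) ⟩
  + 1 + + 3 * (S (suc l) * S (suc l)) ∎
  where
  open ≡-Reasoning
  identity₁ : ∀ x y → (+ 2 * x + + 3 * y) * (+ 2 * x + + 3 * y) ≡ x * x + (+ 3 * (x * x) + + 12 * x * y + + 9 * (y * y))
  identity₁ = solve-∀
  identity₂ : ∀ x y → + 1 + + 3 * (y * y) + (+ 3 * (x * x) + + 12 * x * y + + 9 * (y * y)) ≡ + 1 + + 3 * ((x + + 2 * y) * (x + + 2 * y))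
  identity₂ = solve-∀

-- Binomial transforms with weight iᵏ

WC WS : (ℕ → ℤ) → ℕ → ℤ
WC g = W (λ k → co k * g k)
WS g = W (λ k → si k * g k)

WC-suc : ∀ g n → WC g (suc n) ≡ WC g n - WS (λ k → g (suc k)) n
WC-suc g n = cong (λ x → WC g n + x) (begin
  W (λ k → - si k * g (suc k)) n            ≡⟨ W-cong n (λ k → neg (si k) (g (suc k))) ⟩
  W (λ k → - + 1 * (si k * g (suc k))) n    ≡⟨ W-scale (- + 1) (λ k → si k * g (suc k)) n ⟩
  - + 1 * WS (λ k → g (suc k)) n            ≡⟨ ℤₚ.-1*i≡-i _ ⟩
  - WS (λ k → g (suc k)) n                  ∎)
  where
  open ≡-Reasoning
  neg : ∀ x y → - x * y ≡ - + 1 * (x * y)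
  neg = solve-∀

-- (1 + iω)² = iω(2 + iω - i/ω) and iω - i/ω = ±√3 for a primitive cube root of unity ω;
-- g and g̃ are the combinations ωʲ + ω⁻ʲ and (ωʲ - ω⁻ʲ) / √-3 along a progression of exponents j.
W-closed : ∀ l (g g̃ : ℕ → ℤ) →
  (∀ k → g k - g (suc (suc k)) ≡ - + 3 * g̃ (suc k)) → (∀ k → g̃ k - g̃ (suc (suc k)) ≡ g (suc k)) →
  WC g (dbl 0 l) ≡ co l * (u l * g l) - si l * (+ 3 * S l * g̃ l) ×
  WS g (dbl 0 l) ≡ si l * (u l * g l) + co l * (+ 3 * S l * g̃ l)
W-closed zero g g̃ _ _ = identity₁ (g 0) (g̃ 0) , identity₂ (g 0) (g̃ 0)
  where
  identity₁ : ∀ x y → + 1 * x ≡ + 1 * (+ 1 * x) - + 0 * (+ 3 * + 0 * y)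
  identity₁ = solve-∀
  identity₂ : ∀ x y → + 0 * x ≡ + 0 * (+ 1 * x) + + 1 * (+ 3 * + 0 * y)
  identity₂ = solve-∀
W-closed (suc l) g g̃ gRel g̃Rel = cosine , sine
  where
  open ≡-Reasoning
  n = dbl 0 l
  g₁ = λ k → g (suc k)
  g₂ = λ k → g (suc (suc k))
  -- Two Pascal steps bring in g shifted by 0, 1 and 2. The hypotheses on g and g̃ are stable under
  -- shifts, which is why the induction runs over all such pairs instead of over w and χ.
  ih₀ = W-closed l g g̃ gRel g̃Rel
  ih₁ = W-closed l g₁ (λ k → g̃ (suc k)) (λ k → gRel (suc k)) (λ k → g̃Rel (suc k))
  ih₂ = W-closed l g₂ (λ k → g̃ (suc (suc k))) (λ k → gRel (suc (suc k))) (λ k → g̃Rel (suc (suc k)))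
  step-WC : WC g (suc (suc n)) ≡ WC g n - + 2 * WS g₁ n - WC g₂ n
  step-WC = trans (WC-suc g (suc n)) (trans (cong (_- WS g₁ (suc n)) (WC-suc g n)) (identity (WC g n) (WS g₁ n) (WC g₂ n)))
    where
    identity : ∀ x y z → x - y - (y + z) ≡ x - + 2 * y - z
    identity = solve-∀
  step-WS : WS g (suc (suc n)) ≡ WS g n + + 2 * WC g₁ n - WS g₂ n
  step-WS = trans (cong (λ x → WS g n + WC g₁ n + x) (WC-suc g₁ n)) (identity (WS g n) (WC g₁ n) (WS g₂ n))
    where
    identity : ∀ x y z → x + y + (y - z) ≡ x + + 2 * y - z
    identity = solve-∀
  cosine : WC g (suc (suc n)) ≡ co (suc l) * (u (suc l) * g (suc l)) - si (suc l) * (+ 3 * S (suc l) * g̃ (suc l))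
  cosine = begin
    WC g (suc (suc n))
      ≡⟨ step-WC ⟩
    WC g n - + 2 * WS g₁ n - WC g₂ n
      ≡⟨ cong₂ _-_ (cong₂ (λ x y → x - + 2 * y) (proj₁ ih₀) (proj₂ ih₁)) (proj₁ ih₂) ⟩
    (co l * (u l * g l) - si l * (+ 3 * S l * g̃ l)) - + 2 * (si l * (u l * g (suc l)) + co l * (+ 3 * S l * g̃ (suc l))) - (co l * (u l * g (suc (suc l))) - si l * (+ 3 * S l * g̃ (suc (suc l))))
      ≡⟨ identity₁ (co l) (si l) (u l) (S l) (g l) (g (suc l)) (g (suc (suc l))) (g̃ l) (g̃ (suc l)) (g̃ (suc (suc l))) ⟩
    co l * u l * (g l - g (suc (suc l))) - si l * (+ 3 * S l) * (g̃ l - g̃ (suc (suc l))) - + 2 * (si l * (u l * g (suc l)) + co l * (+ 3 * S l * g̃ (suc l)))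
      ≡⟨ cong₂ (λ x y → co l * u l * x - si l * (+ 3 * S l) * y - + 2 * (si l * (u l * g (suc l)) + co l * (+ 3 * S l * g̃ (suc l)))) (gRel l) (g̃Rel l) ⟩
    co l * u l * (- + 3 * g̃ (suc l)) - si l * (+ 3 * S l) * g (suc l) - + 2 * (si l * (u l * g (suc l)) + co l * (+ 3 * S l * g̃ (suc l)))
      ≡⟨ identity₂ (co l) (si l) (u l) (S l) (g (suc l)) (g̃ (suc l)) ⟩
    - si l * ((+ 2 * u l + + 3 * S l) * g (suc l)) - co l * (+ 3 * (u l + + 2 * S l) * g̃ (suc l))
      ≡⟨ cong₂ (λ x y → - si l * (x * g (suc l)) - co l * (+ 3 * y * g̃ (suc l))) (sym (u-suc l)) (sym (S-suc l)) ⟩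
    - si l * (u (suc l) * g (suc l)) - co l * (+ 3 * S (suc l) * g̃ (suc l)) ∎
    where
    identity₁ : ∀ c s u S g₀ g₁ g₂ x₀ x₁ x₂ → (c * (u * g₀) - s * (+ 3 * S * x₀)) - + 2 * (s * (u * g₁) + c * (+ 3 * S * x₁)) - (c * (u * g₂) - s * (+ 3 * S * x₂)) ≡ c * u * (g₀ - g₂) - s * (+ 3 * S) * (x₀ - x₂) - + 2 * (s * (u * g₁) + c * (+ 3 * S * x₁))
    identity₁ = solve-∀
    identity₂ : ∀ c s u S g x → c * u * (- + 3 * x) - s * (+ 3 * S) * g - + 2 * (s * (u * g) + c * (+ 3 * S * x)) ≡ - s * ((+ 2 * u + + 3 * S) * g) - c * (+ 3 * (u + + 2 * S) * x)
    identity₂ = solve-∀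
  sine : WS g (suc (suc n)) ≡ si (suc l) * (u (suc l) * g (suc l)) + co (suc l) * (+ 3 * S (suc l) * g̃ (suc l))
  sine = begin
    WS g (suc (suc n))
      ≡⟨ step-WS ⟩
    WS g n + + 2 * WC g₁ n - WS g₂ n
      ≡⟨ cong₂ _-_ (cong₂ (λ x y → x + + 2 * y) (proj₂ ih₀) (proj₁ ih₁)) (proj₂ ih₂) ⟩
    (si l * (u l * g l) + co l * (+ 3 * S l * g̃ l)) + + 2 * (co l * (u l * g (suc l)) - si l * (+ 3 * S l * g̃ (suc l))) - (si l * (u l * g (suc (suc l))) + co l * (+ 3 * S l * g̃ (suc (suc l))))
      ≡⟨ identity₁ (co l) (si l) (u l) (S l) (g l) (g (suc l)) (g (suc (suc l))) (g̃ l) (g̃ (suc l)) (g̃ (suc (suc l))) ⟩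
    si l * u l * (g l - g (suc (suc l))) + co l * (+ 3 * S l) * (g̃ l - g̃ (suc (suc l))) + + 2 * (co l * (u l * g (suc l)) - si l * (+ 3 * S l * g̃ (suc l)))
      ≡⟨ cong₂ (λ x y → si l * u l * x + co l * (+ 3 * S l) * y + + 2 * (co l * (u l * g (suc l)) - si l * (+ 3 * S l * g̃ (suc l)))) (gRel l) (g̃Rel l) ⟩
    si l * u l * (- + 3 * g̃ (suc l)) + co l * (+ 3 * S l) * g (suc l) + + 2 * (co l * (u l * g (suc l)) - si l * (+ 3 * S l * g̃ (suc l)))
      ≡⟨ identity₂ (co l) (si l) (u l) (S l) (g (suc l)) (g̃ (suc l)) ⟩
    co l * ((+ 2 * u l + + 3 * S l) * g (suc l)) + - si l * (+ 3 * (u l + + 2 * S l) * g̃ (suc l))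
      ≡⟨ cong₂ (λ x y → co l * (x * g (suc l)) + - si l * (+ 3 * y * g̃ (suc l))) (sym (u-suc l)) (sym (S-suc l)) ⟩
    co l * (u (suc l) * g (suc l)) + - si l * (+ 3 * S (suc l) * g̃ (suc l)) ∎
    where
    identity₁ : ∀ c s u S g₀ g₁ g₂ x₀ x₁ x₂ → (s * (u * g₀) + c * (+ 3 * S * x₀)) + + 2 * (c * (u * g₁) - s * (+ 3 * S * x₁)) - (s * (u * g₂) + c * (+ 3 * S * x₂)) ≡ s * u * (g₀ - g₂) + c * (+ 3 * S) * (x₀ - x₂) + + 2 * (c * (u * g₁) - s * (+ 3 * S * x₁))
    identity₁ = solve-∀
    identity₂ : ∀ c s u S g x → s * u * (- + 3 * x) + c * (+ 3 * S) * g + + 2 * (c * (u * g) - s * (+ 3 * S * x)) ≡ c * ((+ 2 * u + + 3 * S) * g) + - s * (+ 3 * (u + + 2 * S) * x)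
    identity₂ = solve-∀

-- Closed forms of X and Y

module _ (h : ℕ) where

  private
    p = suc (dbl 0 h)

  g : ℕ → ℤ
  g k = w (dbl p k)

  X Y : ℤ
  X = WC g p
  Y = WS g p

  private
    g̃ : ℕ → ℤ
    g̃ k = χ (dbl p k)
    gRel : ∀ k → g k - g (suc (suc k)) ≡ - + 3 * g̃ (suc k)
    gRel k = w-difference₄ (dbl p k)
    g̃Rel : ∀ k → g̃ k - g̃ (suc (suc k)) ≡ g (suc k)
    g̃Rel k = χ-difference₄ (dbl p k)
    closed₀ = W-closed h g g̃ gRel g̃Rel
    closed₁ = W-closed h (λ k → g (suc k)) (λ k → g̃ (suc k)) (λ k → gRel (suc k)) (λ k → g̃Rel (suc k))
    w-per : ∀ k → w (suc (suc (suc k))) ≡ w k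
    w-per _ = refl
    χ-per : ∀ k → χ (suc (suc (suc k))) ≡ χ k
    χ-per _ = refl
    g-h : g h ≡ w (suc h)
    g-h = periodic-1+4h w w-per h
    g-1+h : g (suc h) ≡ w h
    g-1+h = periodic-1+4h (λ k → w (suc (suc k))) (λ k → w-per (suc (suc k))) h
    g̃-h : g̃ h ≡ χ (suc h)
    g̃-h = periodic-1+4h χ χ-per h
    g̃-1+h : g̃ (suc h) ≡ χ h
    g̃-1+h = periodic-1+4h (λ k → χ (suc (suc k))) (λ k → χ-per (suc (suc k))) h

  X-closed : X ≡ co h * (u h * w (suc h)) - si h * (+ 3 * S h * χ (suc h)) - (si h * (u h * w h) + co h * (+ 3 * S h * χ h))
  X-closed = trans (WC-suc g (dbl 0 h)) (cong₂ _-_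
    (trans (proj₁ closed₀) (cong₂ (λ x y → co h * (u h * x) - si h * (+ 3 * S h * y)) g-h g̃-h))
    (trans (proj₂ closed₁) (cong₂ (λ x y → si h * (u h * x) + co h * (+ 3 * S h * y)) g-1+h g̃-1+h)))

  Y-closed : Y ≡ si h * (u h * w (suc h)) + co h * (+ 3 * S h * χ (suc h)) + (co h * (u h * w h) - si h * (+ 3 * S h * χ h))
  Y-closed = cong₂ _+_
    (trans (proj₂ closed₀) (cong₂ (λ x y → si h * (u h * x) + co h * (+ 3 * S h * y)) g-h g̃-h))
    (trans (proj₁ closed₁) (cong₂ (λ x y → co h * (u h * x) - si h * (+ 3 * S h * y)) g-1+h g̃-1+h))

-- iʰ is κ for even h and κ i for odd h.
i-power : ∀ h → ∃ λ κ → (κ ≡ + 1 ⊎ κ ≡ - + 1) × ((co h ≡ κ × si h ≡ + 0 × sg h ≡ + 1) ⊎ (co h ≡ + 0 × si h ≡ κ × sg h ≡ - + 1))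
i-power zero = + 1 , inj₁ refl , inj₁ (refl , refl , refl)
i-power (suc h) with i-power h
... | κ , κ±1 , inj₁ (c , s , e) = κ , κ±1 , inj₂ (cong -_ s , c , cong -_ e)
... | κ , inj₁ κ≡1 , inj₂ (c , s , e) = - κ , inj₂ (cong -_ κ≡1) , inj₁ (cong -_ s , c , cong -_ e)
... | κ , inj₂ κ≡-1 , inj₂ (c , s , e) = - κ , inj₁ (cong -_ κ≡-1) , inj₁ (cong -_ s , c , cong -_ e)

residue-3 : ∀ h → (w (suc h) ≡ - + 1 × χ (suc h) ≡ + 1 × w h ≡ + 2 × χ h ≡ + 0)
  ⊎ (w (suc h) ≡ + 2 × χ (suc h) ≡ + 0 × w h ≡ - + 1 × χ h ≡ - + 1)
  ⊎ 3 ℕ∣.∣ suc (dbl 0 h)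
residue-3 0 = inj₁ (refl , refl , refl , refl)
residue-3 1 = inj₂ (inj₂ ℕ∣.∣-refl)
residue-3 2 = inj₂ (inj₁ (refl , refl , refl , refl))
residue-3 (suc (suc (suc h))) with residue-3 h
... | inj₁ r = inj₁ r
... | inj₂ (inj₁ r) = inj₂ (inj₁ r)
... | inj₂ (inj₂ 3∣p) = inj₂ (inj₂ (ℕ∣.∣m∣n⇒∣m+n (ℕ∣.divides 2 refl) 3∣p))

-- The parity of h and its residue modulo 3 give four cases, which collapse to two once κ may change
-- sign. As 2u + 3S is u at h + 1, the shapes differ in which of X and Y carries the index h and
-- which h + 1. They correspond to p ≡ ±1 and p ≡ ±5 modulo 12.
XY-shape : ∀ h → ¬ 3 ℕ∣.∣ suc (dbl 0 h) → ∃ λ κ → (κ ≡ + 1 ⊎ κ ≡ - + 1) ×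
  ((X h ≡ - (sg h * κ * u h) × Y h ≡ κ * (+ 2 * u h + + 3 * S h)) ⊎
   (X h ≡ - (sg h * κ * (+ 2 * u h + + 3 * S h)) × Y h ≡ κ * u h))
XY-shape h 3∤p with residue-3 h
... | inj₂ (inj₂ 3∣p) = ⊥-elim (3∤p 3∣p)
... | inj₁ (w₁ , χ₁ , w₀ , χ₀) with i-power h | X-closed h | Y-closed h
... | κ , κ±1 , inj₁ (c , s , e) | x | y rewrite w₁ | χ₁ | w₀ | χ₀ | c | s | e =
  κ , κ±1 , inj₁ (trans x (identity₁ κ (u h) (S h)) , trans y (identity₂ κ (u h) (S h)))
  where
  identity₁ : ∀ κ u S → κ * (u * - + 1) - + 0 * (+ 3 * S * + 1) - (+ 0 * (u * + 2) + κ * (+ 3 * S * + 0)) ≡ - (+ 1 * κ * u)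
  identity₁ = solve-∀
  identity₂ : ∀ κ u S → + 0 * (u * - + 1) + κ * (+ 3 * S * + 1) + (κ * (u * + 2) - + 0 * (+ 3 * S * + 0)) ≡ κ * (+ 2 * u + + 3 * S)
  identity₂ = solve-∀
... | κ , κ±1 , inj₂ (c , s , e) | x | y rewrite w₁ | χ₁ | w₀ | χ₀ | c | s | e =
  - κ , [ (λ eq → inj₂ (cong -_ eq)) , (λ eq → inj₁ (cong -_ eq)) ]′ κ±1 , inj₂ (trans x (identity₁ κ (u h) (S h)) , trans y (identity₂ κ (u h) (S h)))
  where
  identity₁ : ∀ κ u S → + 0 * (u * - + 1) - κ * (+ 3 * S * + 1) - (κ * (u * + 2) + + 0 * (+ 3 * S * + 0)) ≡ - (- + 1 * - κ * (+ 2 * u + + 3 * S))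
  identity₁ = solve-∀
  identity₂ : ∀ κ u S → κ * (u * - + 1) + + 0 * (+ 3 * S * + 1) + (+ 0 * (u * + 2) - κ * (+ 3 * S * + 0)) ≡ - κ * u
  identity₂ = solve-∀
XY-shape h 3∤p | inj₂ (inj₁ (w₁ , χ₁ , w₀ , χ₀)) with i-power h | X-closed h | Y-closed h
... | κ , κ±1 , inj₁ (c , s , e) | x | y rewrite w₁ | χ₁ | w₀ | χ₀ | c | s | e =
  - κ , [ (λ eq → inj₂ (cong -_ eq)) , (λ eq → inj₁ (cong -_ eq)) ]′ κ±1 , inj₂ (trans x (identity₁ κ (u h) (S h)) , trans y (identity₂ κ (u h) (S h)))
  where
  identity₁ : ∀ κ u S → κ * (u * + 2) - + 0 * (+ 3 * S * + 0) - (+ 0 * (u * - + 1) + κ * (+ 3 * S * - + 1)) ≡ - (+ 1 * - κ * (+ 2 * u + + 3 * S))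
  identity₁ = solve-∀
  identity₂ : ∀ κ u S → + 0 * (u * + 2) + κ * (+ 3 * S * + 0) + (κ * (u * - + 1) - + 0 * (+ 3 * S * - + 1)) ≡ - κ * u
  identity₂ = solve-∀
... | κ , κ±1 , inj₂ (c , s , e) | x | y rewrite w₁ | χ₁ | w₀ | χ₀ | c | s | e =
  κ , κ±1 , inj₁ (trans x (identity₁ κ (u h) (S h)) , trans y (identity₂ κ (u h) (S h)))
  where
  identity₁ : ∀ κ u S → + 0 * (u * + 2) - κ * (+ 3 * S * + 0) - (κ * (u * - + 1) + + 0 * (+ 3 * S * - + 1)) ≡ - (- + 1 * κ * u)
  identity₁ = solve-∀
  identity₂ : ∀ κ u S → κ * (u * + 2) + + 0 * (+ 3 * S * + 0) + (+ 0 * (u * - + 1) - κ * (+ 3 * S * - + 1)) ≡ κ * (+ 2 * u + + 3 * S)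
  identity₂ = solve-∀

-- Powers of 1 + √3, and signs

-- real and irrational parts of √3ᵏ
√3-re √3-im : ℕ → ℤ
√3-re zero = + 1
√3-re (suc k) = + 3 * √3-im k
√3-im zero = + 0
√3-im (suc k) = √3-re k

√3-re-dbl : ∀ l → √3-re (dbl 0 l) ≡ (+ 3) ^ l
√3-re-dbl zero = refl
√3-re-dbl (suc l) = cong (+ 3 *_) (√3-re-dbl l)

√3-im-dbl : ∀ l → √3-im (dbl 0 l) ≡ + 0
√3-im-dbl zero = refl
√3-im-dbl (suc l) = cong (+ 3 *_) (√3-im-dbl l)

W-√3-re-suc : ∀ n → W √3-re (suc n) ≡ W √3-re n + + 3 * W √3-im n
W-√3-re-suc n = cong (λ x → W √3-re n + x) (W-scale (+ 3) √3-im n)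

-- (1 + √3)²ˡ = 2ˡ (2 + √3)ˡ
W-√3 : ∀ l → W √3-re (dbl 0 l) ≡ (+ 2) ^ l * u l × W √3-im (dbl 0 l) ≡ (+ 2) ^ l * S l
W-√3 zero = refl , refl
W-√3 (suc l) with W-√3 l
... | re , im =
    trans (W-√3-re-suc (suc n)) (trans (cong (_+ + 3 * W √3-im (suc n)) (W-√3-re-suc n))
      (trans (identity₁ (W √3-re n) (W √3-im n)) (trans (cong₂ (λ x y → + 2 * (+ 2 * x + + 3 * y)) re im)
      (trans (identity₂ ((+ 2) ^ l) (u l) (S l)) (cong ((+ 2) ^ suc l *_) (sym (u-suc l)))))))
  , trans (cong (λ x → W √3-im n + W √3-re n + x) (W-√3-re-suc n))
      (trans (identity₃ (W √3-re n) (W √3-im n)) (trans (cong₂ (λ x y → + 2 * (x + + 2 * y)) re im)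
      (trans (identity₄ ((+ 2) ^ l) (u l) (S l)) (cong ((+ 2) ^ suc l *_) (sym (S-suc l))))))
  where
  n = dbl 0 l
  identity₁ : ∀ x y → x + + 3 * y + + 3 * (y + x) ≡ + 2 * (+ 2 * x + + 3 * y)
  identity₁ = solve-∀
  identity₂ : ∀ e u S → + 2 * (+ 2 * (e * u) + + 3 * (e * S)) ≡ + 2 * e * (+ 2 * u + + 3 * S)
  identity₂ = solve-∀
  identity₃ : ∀ x y → y + x + (x + + 3 * y) ≡ + 2 * (x + + 2 * y)
  identity₃ = solve-∀
  identity₄ : ∀ e u S → + 2 * (e * u + + 2 * (e * S)) ≡ + 2 * e * (u + + 2 * S)
  identity₄ = solve-∀

w-∤ : ∀ j → ¬ 3 ℕ∣.∣ j → w j ≡ - + 1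
w-∤ 0 3∤0 = ⊥-elim (3∤0 (ℕ∣.divides 0 refl))
w-∤ 1 _ = refl
w-∤ 2 _ = refl
w-∤ (suc (suc (suc j))) 3∤ = w-∤ j (λ 3∣j → 3∤ (ℕ∣.∣m∣n⇒∣m+n (ℕ∣.divides 1 refl) 3∣j))

sg² : ∀ k → sg k * sg k ≡ + 1
sg² zero = refl
sg² (suc k) = trans (identity (sg k)) (sg² k)
  where
  identity : ∀ x → - x * - x ≡ x * x
  identity = solve-∀

power-neg2 : ∀ h → (- + 2) ^ h ≡ sg h * (+ 2) ^ h
power-neg2 zero = refl
power-neg2 (suc h) = trans (cong (- + 2 *_) (power-neg2 h)) (identity (sg h) ((+ 2) ^ h))
  where
  identity : ∀ s e → - + 2 * (s * e) ≡ - s * (+ 2 * e)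
  identity = solve-∀

IsSign : ℤ → Set
IsSign x = x ≡ + 1 ⊎ x ≡ - + 1

IsSign-sg : ∀ k → IsSign (sg k)
IsSign-sg zero = inj₁ refl
IsSign-sg (suc k) = [ (λ eq → inj₂ (cong -_ eq)) , (λ eq → inj₁ (cong -_ eq)) ]′ (IsSign-sg k)

IsSign-* : ∀ {x y} → IsSign x → IsSign y → IsSign (x * y)
IsSign-* (inj₁ refl) (inj₁ refl) = inj₁ refl
IsSign-* (inj₁ refl) (inj₂ refl) = inj₂ refl
IsSign-* (inj₂ refl) (inj₁ refl) = inj₂ refl
IsSign-* (inj₂ refl) (inj₂ refl) = inj₁ refl

IsSign-square : ∀ {x} → IsSign x → x * x ≡ + 1
IsSign-square (inj₁ refl) = refl
IsSign-square (inj₂ refl) = refl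

-- Polynomial congruences

power-dbl : ∀ a h → a ^ dbl 0 h ≡ (a * a) ^ h
power-dbl a zero = refl
power-dbl a (suc h) = trans (cong (λ x → a * (a * x)) (power-dbl a h)) (sym (ℤₚ.*-assoc a a ((a * a) ^ h)))

power-* : ∀ a c h → (a * c) ^ h ≡ a ^ h * c ^ h
power-* a c zero = refl
power-* a c (suc h) = trans (cong (a * c *_) (power-* a c h)) (identity a c (a ^ h) (c ^ h))
  where
  identity : ∀ a c x y → a * c * (x * y) ≡ a * x * (c * y)
  identity = solve-∀

power-∣ : ∀ {m x y} n → m ∣ x - y → m ∣ x ^ n - y ^ n
power-∣ zero _ = ∣0
power-∣ {m} {x} {y} (suc n) m∣x-y = ∣-combination (x ^ n) y m∣x-y (power-∣ n m∣x-y) (identity x y (x ^ n) (y ^ n))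
  where
  identity : ∀ x y a c → x * a - y * c ≡ a * (x - y) + y * (a - c)
  identity = solve-∀

abs-square : ∀ a → + ∣ a ∣ * + ∣ a ∣ ≡ a * a
abs-square (+ _) = refl
abs-square -[1+ _ ] = refl

W-power : ∀ a n → W (a ^_) n ≡ (+ 1 + a) ^ n
W-power a zero = refl
W-power a (suc n) = trans (cong (λ x → W (a ^_) n + x) (W-scale a (a ^_) n)) (trans (cong (λ x → x + a * x) (W-power a n)) (identity a ((+ 1 + a) ^ n)))
  where
  identity : ∀ a x → x + a * x ≡ (+ 1 + a) * x
  identity = solve-∀

-- f is a polynomial function of degree at most n: f(x) - f(r) = (x - r) q(x) with q of smaller degree.
Polynomial : ℕ → (ℤ → ℤ) → Set
Polynomial zero f = ∀ x y → f x ≡ f y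
Polynomial (suc n) f = ∀ r → ∃ λ q → Polynomial n q × (∀ x → f x ≡ f r + (x - r) * q x)

Polynomial-suc : ∀ n {f} → Polynomial n f → Polynomial (suc n) f
Polynomial-suc zero {f} const r = (λ _ → + 0) , (λ _ _ → refl) , λ x → trans (const x r) (identity (f r) (x - r))
  where
  identity : ∀ a d → a ≡ a + d * + 0
  identity = solve-∀
Polynomial-suc (suc n) poly r with poly r
... | q , poly-q , factor = q , Polynomial-suc n poly-q , factor

Polynomial-affine : ∀ n {f g} a → Polynomial n f → Polynomial n g → Polynomial n (λ x → f x + a * g x)
Polynomial-affine zero a pf pg x y = cong₂ (λ s t → s + a * t) (pf x y) (pg x y)
Polynomial-affine (suc n) {f} {g} a pf pg r with pf r | pg r
... | q , pq , f≡ | q′ , pq′ , g≡ = (λ x → q x + a * q′ x) , Polynomial-affine n a pq pq′ ,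
    λ x → trans (cong₂ (λ s t → s + a * t) (f≡ x) (g≡ x)) (identity (f r) (g r) a (x - r) (q x) (q′ x))
  where
  identity : ∀ f g a d q q′ → f + d * q + a * (g + d * q′) ≡ f + a * g + d * (q + a * q′)
  identity = solve-∀

Polynomial-const : ∀ n c → Polynomial n (λ _ → c)
Polynomial-const zero c = λ _ _ → refl
Polynomial-const (suc n) c = Polynomial-suc n (Polynomial-const n c)

Polynomial-power : ∀ n → Polynomial n (_^ n)
Polynomial-power zero _ _ = refl
Polynomial-power (suc n) r with Polynomial-suc n (Polynomial-power n) r
... | q , pq , factor = (λ x → x ^ n + r * q x) , Polynomial-affine n r (Polynomial-power n) pq , λ x → begin
    x * x ^ n                                          ≡⟨ identity₁ x r (x ^ n) ⟩
    r * x ^ n + (x - r) * x ^ n                        ≡⟨ cong (λ y → r * y + (x - r) * x ^ n) (factor x) ⟩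
    r * (r ^ n + (x - r) * q x) + (x - r) * x ^ n      ≡⟨ identity₂ r (r ^ n) (x - r) (q x) (x ^ n) ⟩
    r * r ^ n + (x - r) * (x ^ n + r * q x)            ∎
  where
  open ≡-Reasoning
  identity₁ : ∀ x r y → x * y ≡ r * y + (x - r) * y
  identity₁ = solve-∀
  identity₂ : ∀ r s d q y → r * (s + d * q) + d * y ≡ r * s + d * (y + r * q)
  identity₂ = solve-∀

-- Splitting off the last root leaves a quotient of smaller degree. It vanishes modulo p at the
-- other roots, since their distances to the last one are prime to p.
lagrange : ∀ {p} → Prime p → ∀ n {f} → Polynomial n f → (r : ℕ → ℤ) →
  (∀ i → i ℕ.≤ n → + p ∣ f (r i)) → (∀ i j → i < j → j ℕ.≤ n → ¬ + p ∣ r j - r i) → ∀ x → + p ∣ f x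
lagrange pp zero poly r roots distinct x = ∣-cong (poly (r 0) x) (roots 0 z≤n)
lagrange {p} pp (suc n) {f} poly r roots distinct x with poly (r (suc n))
... | q , poly-q , factor = ∣-combination (+ 1) (x - r (suc n)) (roots (suc n) ℕₚ.≤-refl) (lagrange pp n poly-q r roots-q (λ i j i<j j≤n → distinct i j i<j (ℕₚ.m≤n⇒m≤1+n j≤n)) x)
    (trans (factor x) (cong (_+ (x - r (suc n)) * q x) (sym (ℤₚ.*-identityˡ (f (r (suc n)))))))
  where
  identity : ∀ a b d q → a ≡ b + d * q → - d * q ≡ + 1 * b + (- + 1) * a
  identity a b d q refl = expand b d q
    where
    expand : ∀ b d q → - d * q ≡ + 1 * b + (- + 1) * (b + d * q)
    expand = solve-∀
  flip : ∀ x y → - (x - y) ≡ y - x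
  flip = solve-∀
  roots-q : ∀ i → i ℕ.≤ n → + p ∣ q (r i)
  roots-q i i≤n = cancel-coprime pp (distinct i (suc n) (s≤s i≤n) ℕₚ.≤-refl)
    (subst (λ d → + p ∣ d * q (r i)) (flip (r i) (r (suc n)))
      (∣-combination (+ 1) (- + 1) (roots (suc n) ℕₚ.≤-refl) (roots i (ℕₚ.m≤n⇒m≤1+n i≤n)) (identity (f (r i)) (f (r (suc n))) (r i - r (suc n)) (q (r i)) (factor (r i)))))

dbl≡*2 : ∀ h → dbl 0 h ≡ h ℕ.* 2
dbl≡*2 zero = refl
dbl≡*2 (suc h) = cong (λ x → suc (suc x)) (dbl≡*2 h)

dbl≡+ : ∀ h → dbl 0 h ≡ h ℕ.+ h
dbl≡+ zero = refl
dbl≡+ (suc h) = cong suc (trans (cong suc (dbl≡+ h)) (sym (ℕₚ.+-suc h h)))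

-- Rational numbers

ι : ℤ → ℚ
ι z = z / 1

toℚᵘ-ι : ∀ z → toℚᵘ (ι z) ℚᵘ.≃ ℚᵘ.mkℚᵘ z 0
toℚᵘ-ι z = ℚₚ.toℚᵘ-fromℚᵘ (ℚᵘ.mkℚᵘ z 0)

ι-+ : ∀ x y → ι (x + y) ≡ ι x ℚ.+ ι y
ι-+ x y = ℚₚ.toℚᵘ-injective (ℚᵘₚ.≃-trans (toℚᵘ-ι (x + y)) (ℚᵘₚ.≃-sym (ℚᵘₚ.≃-trans (ℚₚ.toℚᵘ-homo-+ (ι x) (ι y))
  (ℚᵘₚ.≃-trans (ℚᵘₚ.+-cong (toℚᵘ-ι x) (toℚᵘ-ι y)) (ℚᵘ.*≡* (identity x y))))))
  where
  identity : ∀ x y → (x * + 1 + y * + 1) * + 1 ≡ (x + y) * + 1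
  identity = solve-∀

ι-* : ∀ x y → ι (x * y) ≡ ι x ℚ.* ι y
ι-* x y = ℚₚ.toℚᵘ-injective (ℚᵘₚ.≃-trans (toℚᵘ-ι (x * y)) (ℚᵘₚ.≃-sym (ℚᵘₚ.≃-trans (ℚₚ.toℚᵘ-homo-* (ι x) (ι y))
  (ℚᵘₚ.≃-trans (ℚᵘₚ.*-cong (toℚᵘ-ι x) (toℚᵘ-ι y)) (ℚᵘ.*≡* refl)))))

ι-neg : ∀ x → ι (- x) ≡ ℚ.- ι x
ι-neg x = ℚₚ.toℚᵘ-injective (ℚᵘₚ.≃-trans (toℚᵘ-ι (- x)) (ℚᵘₚ.≃-sym (ℚᵘₚ.≃-trans (ℚₚ.toℚᵘ-homo‿- (ι x))
  (ℚᵘₚ.-‿cong (toℚᵘ-ι x)))))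

ι-sub : ∀ x y → ι (x - y) ≡ ι x ℚ.- ι y
ι-sub x y = trans (ι-+ x (- y)) (cong (ι x ℚ.+_) (ι-neg y))

ι-sg : ∀ k → ι (sg k) ≡ sgn k
ι-sg zero = refl
ι-sg (suc k) = trans (ι-neg (sg k)) (cong ℚ.-_ (ι-sg k))

sgn² : ∀ k → sgn k ℚ.* sgn k ≡ 1ℚ
sgn² k = trans (cong₂ ℚ._*_ (sym (ι-sg k)) (sym (ι-sg k))) (trans (sym (ι-* (sg k) (sg k))) (cong ι (sg² k)))

ι-recip : ∀ k → ι (+ suc k) ℚ.* recip (suc k) ≡ 1ℚ
ι-recip k = ℚₚ.toℚᵘ-injective (ℚᵘₚ.≃-trans (ℚₚ.toℚᵘ-homo-* (ι (+ suc k)) (recip (suc k)))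
  (ℚᵘₚ.≃-trans (ℚᵘₚ.*-cong (toℚᵘ-ι (+ suc k)) (ℚₚ.toℚᵘ-fromℚᵘ (ℚᵘ.mkℚᵘ (+ 1) k))) (ℚᵘ.*≡* (cong +_ (identity k)))))
  where
  identity : ∀ k → suc k ℕ.* 1 ℕ.* 1 ≡ 1 ℕ.* (1 ℕ.* suc k)
  identity k = trans (ℕₚ.*-identityʳ _) (trans (ℕₚ.*-identityʳ (suc k)) (sym (trans (ℕₚ.*-identityˡ _) (ℕₚ.*-identityˡ (suc k)))))

recip-unique : ∀ k {x} → ι (+ suc k) ℚ.* x ≡ 1ℚ → recip (suc k) ≡ x
recip-unique k {x} eq = begin
  r                            ≡⟨ sym (ℚₚ.*-identityʳ r) ⟩
  r ℚ.* 1ℚ                     ≡⟨ cong (r ℚ.*_) (sym eq) ⟩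
  r ℚ.* (ι (+ suc k) ℚ.* x)    ≡⟨ solve 3 (λ r i x → r :* (i :* x) := i :* r :* x) refl r (ι (+ suc k)) x ⟩
  ι (+ suc k) ℚ.* r ℚ.* x      ≡⟨ cong (ℚ._* x) (ι-recip k) ⟩
  1ℚ ℚ.* x                     ≡⟨ ℚₚ.*-identityˡ x ⟩
  x                            ∎
  where
  open ≡-Reasoning
  r = recip (suc k)

-- The source of the factor 1/2 in the odd case, where the recurrence divides by the even numbers d
-- - 1.
recip-dbl : ∀ m → recip (dbl 0 (suc m)) ≡ (+ 1 / 2) ℚ.* recip (suc m)
recip-dbl m = recip-unique (suc (dbl 0 m)) (begin
  ι (+ dbl 0 (suc m)) ℚ.* (½ ℚ.* r)        ≡⟨ cong (λ x → ι x ℚ.* (½ ℚ.* r)) (trans (cong +_ (dbl≡*2 (suc m))) (ℤₚ.pos-* (suc m) 2)) ⟩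
  ι (+ suc m * + 2) ℚ.* (½ ℚ.* r)          ≡⟨ cong (ℚ._* (½ ℚ.* r)) (ι-* (+ suc m) (+ 2)) ⟩
  ι (+ suc m) ℚ.* ι (+ 2) ℚ.* (½ ℚ.* r)    ≡⟨ solve 2 (λ i r → i :* con (ι (+ 2)) :* (con ½ :* r) := i :* r) refl (ι (+ suc m)) r ⟩
  ι (+ suc m) ℚ.* r                        ≡⟨ ι-recip m ⟩
  1ℚ                                       ∎)
  where
  open ≡-Reasoning
  ½ = + 1 / 2
  r = recip (suc m)

-- Phrased for an arbitrary g so that it applies to the loop local to `sumRange`, which satisfies
-- both equations by computation.
sumBelow-unique : ∀ (f g : ℕ → ℚ) → g 0 ≡ 0ℚ → (∀ n → g (suc n) ≡ g n ℚ.+ f n) → ∀ n → g n ≡ sumBelow n f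
sumBelow-unique f g g₀ step zero = g₀
sumBelow-unique f g g₀ step (suc n) = trans (step n) (cong (ℚ._+ f n) (sumBelow-unique f g g₀ step n))

sumRange-sumBelow : ∀ a b f → sumRange a b f ≡ sumBelow (suc b ∸ a) (λ k → f (a ℕ.+ k))
sumRange-sumBelow a b f = proof
  where
  -- the local function of sumRange, recovered by unification
  go : ℕ → ℚ
  go = _
  proof : sumRange a b f ≡ sumBelow (suc b ∸ a) (λ k → f (a ℕ.+ k))
  -- Once the bound is a variable, the goal determines the function `go` left open above.
  proof with suc b ∸ a
  ... | n = sumBelow-unique (λ k → f (a ℕ.+ k)) go refl (λ _ → refl) n

ι-sum : ∀ n f → sumBelow n (λ k → ι (f k)) ≡ ι (sum n f)
ι-sum zero f = refl
ι-sum (suc n) f = trans (cong (ℚ._+ ι (f n)) (ι-sum n f)) (sym (ι-+ (sum n f) (f n)))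

w-∣ : ∀ j → 3 ℕ∣.∣ j → w j ≡ + 2
w-∣ 0 _ = refl
w-∣ 1 3∣1 = ⊥-elim (ℕ∣.>⇒∤ (s≤s (s≤s z≤n)) 3∣1)
w-∣ 2 3∣2 = ⊥-elim (ℕ∣.>⇒∤ (s≤s (s≤s (s≤s z≤n))) 3∣2)
w-∣ (suc (suc (suc j))) 3∣ = w-∣ j (ℕ∣.∣m+n∣m⇒∣n 3∣ ℕ∣.∣-refl)

-- p + 4m ≡ m + p (mod 3)
periodic-p+4m : ∀ (f : ℕ → ℤ) → (∀ k → f (suc (suc (suc k))) ≡ f k) → ∀ p m → f (dbl p (dbl 0 m)) ≡ f (m ℕ.+ p)
periodic-p+4m f per p zero = refl
periodic-p+4m f per p (suc m) = trans (per (suc (dbl p (dbl 0 m)))) (periodic-p+4m (λ k → f (suc k)) (λ k → per (suc k)) p m)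

-- p-integral rationals

module Integral {p : ℕ} (pp : Prime p) where

  -- A record, because q cannot be inferred from a bare statement about its denominator. The same
  -- reason applies to `_≈_`.
  record Integral (q : ℚ) : Set where
    constructor integral
    field p∤↧ : ¬ p ℕ∣.∣ ↧ₙ q
  open Integral public

  Integral-∣ : ∀ {q} d → ¬ p ℕ∣.∣ d → ↧ₙ q ℕ∣.∣ d → Integral q
  Integral-∣ d p∤d q∣d = integral λ p∣q → p∤d (ℕ∣.∣-trans p∣q q∣d)

  ∤-product : ∀ {m n} → ¬ p ℕ∣.∣ m → ¬ p ℕ∣.∣ n → ¬ p ℕ∣.∣ m ℕ.* n
  ∤-product {m} {n} p∤m p∤n p∣mn = [ p∤m , p∤n ]′ (euclidsLemma m n pp p∣mn)

  -- Here z is a denominator before reduction and k the common factor that reduction cancels.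
  ↧ₙ-∣ : ∀ q {k z} → ℚ.↧ q * k ≡ z → ↧ₙ q ℕ∣.∣ ∣ z ∣
  ↧ₙ-∣ q {k} refl = ℕ∣.divides ∣ k ∣ (trans (ℤₚ.abs-* (ℚ.↧ q) k) (ℕₚ.*-comm (↧ₙ q) ∣ k ∣))

  Integral-+ : ∀ {x y} → Integral x → Integral y → Integral (x ℚ.+ y)
  Integral-+ {x} {y} ix iy = Integral-∣ (↧ₙ x ℕ.* ↧ₙ y) (∤-product (p∤↧ ix) (p∤↧ iy))
    (subst (↧ₙ (x ℚ.+ y) ℕ∣.∣_) (ℤₚ.abs-* (ℚ.↧ x) (ℚ.↧ y)) (↧ₙ-∣ (x ℚ.+ y) (ℚₚ.↧-+ x y)))

  Integral-* : ∀ {x y} → Integral x → Integral y → Integral (x ℚ.* y)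
  Integral-* {x} {y} ix iy = Integral-∣ (↧ₙ x ℕ.* ↧ₙ y) (∤-product (p∤↧ ix) (p∤↧ iy))
    (subst (↧ₙ (x ℚ.* y) ℕ∣.∣_) (ℤₚ.abs-* (ℚ.↧ x) (ℚ.↧ y)) (↧ₙ-∣ (x ℚ.* y) (ℚₚ.↧-* x y)))

  Integral-/ : ∀ z n .{{_ : ℕ.NonZero n}} → ¬ p ℕ∣.∣ n → Integral (z / n)
  Integral-/ z n p∤n = Integral-∣ n p∤n (↧ₙ-∣ (z / n) (ℚₚ.↧-/ z n))

  p∤1 : ¬ p ℕ∣.∣ 1
  p∤1 p∣1 = ¬prime[1] (subst Prime (ℕ∣.∣1⇒≡1 p∣1) pp)

  Integral-ι : ∀ z → Integral (ι z)
  Integral-ι z = Integral-/ z 1 p∤1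

  infix 4 _≈_
  record _≈_ (x y : ℚ) : Set where
    constructor congruent
    field quotient-integral : Integral ((x ℚ.- y) ℚ.* recip p)
  open _≈_ public

  -- The form of the step d to d + 2 in both inductions on d.
  ≈-affine : ∀ {a a′ x x′} c → Integral c → a ≈ a′ → x ≈ x′ → a ℚ.+ c ℚ.* x ≈ a′ ℚ.+ c ℚ.* x′
  ≈-affine {a} {a′} {x} {x′} c ic (congruent a≈) (congruent x≈) = congruent (subst Integral
    (solve 6 (λ a a′ x x′ c r → (a :- a′) :* r :+ c :* ((x :- x′) :* r) := ((a :+ c :* x) :- (a′ :+ c :* x′)) :* r) refl a a′ x x′ c (recip p))
    (Integral-+ a≈ (Integral-* ic x≈)))

-- Binomial coefficients modulo p = 2h + 1

module OddPrime (h : ℕ) (pp : Prime (suc (dbl 0 h))) (3<p : 3 < suc (dbl 0 h)) where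

  n p : ℕ
  n = dbl 0 h
  p = suc n

  ∤1 : ¬ + p ∣ + 1
  ∤1 = ∤-small (ℕₚ.<-trans (s≤s (s≤s z≤n)) 3<p)

  ∤2 : ¬ + p ∣ + 2
  ∤2 = ∤-small (ℕₚ.<-trans (s≤s (s≤s (s≤s z≤n))) 3<p)

  ∤3 : ¬ + p ∣ + 3
  ∤3 = ∤-small 3<p

  binom-∣ : ∀ k → suc k < p → + p ∣ binom p (suc k)
  binom-∣ k k<p = cancel-coprime pp (∤-small k<p) (divides (binom n k) (trans (binom-absorption n k) (ℤₚ.*-comm (+ p) (binom n k))))

  -- Neighbouring entries of row p - 1 add up to an interior entry of row p, which is divisible by
  -- p.
  binom-sg : ∀ k → k < p → + p ∣ binom n k - sg k
  binom-sg zero _ = ∣0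
  binom-sg (suc k) k<p = ∣-combination (+ 1) (- + 1) (binom-∣ k k<p) (binom-sg k (ℕₚ.<-trans (ℕₚ.n<1+n k) k<p)) (identity (binom n k) (binom n (suc k)) (sg k))
    where
    identity : ∀ x y s → y - - s ≡ + 1 * (x + y) + (- + 1) * (x - s)
    identity = solve-∀

  W-ends : ∀ f → W f p ≡ f 0 + sum n (λ k → binom p (suc k) * f (suc k)) + f p
  W-ends f = trans (W-sum f p) (trans (sum-head p (λ k → binom p k * f k))
    (trans (cong (λ x → + 1 * f 0 + (sum n (λ k → binom p (suc k) * f (suc k)) + x * f p)) (binom-diagonal p)) (identity (f 0) (sum n (λ k → binom p (suc k) * f (suc k))) (f p))))
    where
    identity : ∀ a s c → + 1 * a + (s + + 1 * c) ≡ a + s + c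
    identity = solve-∀

  -- The Frobenius congruence (1+a)^p ≡ 1 + a^p for a general sequence in place of the powers of a.
  -- It serves integer powers as well as the two components of √3ᵏ.
  W-mod : ∀ f → + p ∣ W f p - (f 0 + f p)
  W-mod f = ∣-multiple (+ 1) (sum-∣ n (λ k k<n → ∣m⇒∣m*n (f (suc k)) (binom-∣ k (s≤s k<n))))
    (trans (cong (_- (f 0 + f p)) (W-ends f)) (identity (f 0) (sum n (λ k → binom p (suc k) * f (suc k))) (f p)))
    where
    identity : ∀ a s c → a + s + c - (a + c) ≡ + 1 * s
    identity = solve-∀

  -- Fermat's theorem and Euler's criterion

  fermat : ∀ a → + p ∣ (+ a) ^ p - + a
  fermat zero = ∣0
  fermat (suc a) = ∣-combination (+ 1) (+ 1) (W-mod ((+ a) ^_)) (fermat a)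
    (trans (cong (_- (+ 1 + + a)) (sym (W-power (+ a) p))) (identity (W ((+ a) ^_) p) (+ a) ((+ a) ^ p)))
    where
    identity : ∀ x a c → x - (+ 1 + a) ≡ + 1 * (x - (+ 1 + c)) + + 1 * (c - a)
    identity = solve-∀

  fermat-square : ∀ a → ¬ + p ∣ + a → + p ∣ (+ a * + a) ^ h - + 1
  fermat-square a p∤a = subst (λ x → + p ∣ x - + 1) (power-dbl (+ a) h) (cancel-coprime pp p∤a (∣-cong (identity (+ a) ((+ a) ^ n)) (fermat a)))
    where
    identity : ∀ a c → a * c - a ≡ a * (c - + 1)
    identity = solve-∀

  square-root-of-1 : ∀ a → ¬ + p ∣ a → (+ p ∣ a ^ h - + 1) ⊎ (+ p ∣ a ^ h - - + 1)
  square-root-of-1 a p∤a = euclidℤ pp _ _ (∣-cong (trans (cong (_- + 1) (trans (cong (_^ h) (abs-square a)) (power-* a a h))) (identity (a ^ h)))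
      (fermat-square ∣ a ∣ λ p∣∣a∣ → p∤a (∣ᵤ⇒∣ (∣⇒∣ᵤ p∣∣a∣))))
    where
    identity : ∀ x → x * x - + 1 ≡ (x - + 1) * (x - - + 1)
    identity = solve-∀

  -- Otherwise x^h - 1, of degree h, has h + 1 distinct roots modulo p: the squares of 1, ..., h and
  -- the nonsquare a. It would then vanish everywhere, but its value at 0 is -1.
  root-bound : ∀ a → (∀ x → x < p → ¬ + p ∣ + x * + x - a) → ¬ + p ∣ a ^ h - + 1
  root-bound a nonsquare p∣aʰ-1 = ∤1 (∣-multiple (- + 1) (lagrange pp h {λ x → x ^ h + - + 1 * + 1} poly r roots distinct (+ 0)) (sym (cong (λ x → - + 1 * (x - + 1)) (0^h h 3<p))))
    where
    poly = Polynomial-affine h (- + 1) (Polynomial-power h) (Polynomial-const h (+ 1))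
    h<p : ∀ {i} → i ℕ.≤ h → i < p
    h<p i≤h = s≤s (ℕₚ.≤-trans i≤h (subst (h ℕ.≤_) (sym (dbl≡+ h)) (ℕₚ.m≤m+n h h)))
    r : ℕ → ℤ
    r zero = a
    r (suc i) = + suc i * + suc i
    roots : ∀ i → i ℕ.≤ h → + p ∣ r i ^ h + - + 1 * + 1
    roots zero _ = p∣aʰ-1
    roots (suc i) i<h = fermat-square (suc i) (∤-small (h<p i<h))
    distinct : ∀ i j → i < j → j ℕ.≤ h → ¬ + p ∣ r j - r i
    distinct zero (suc j) _ j≤h = nonsquare (suc j) (h<p j≤h)
    distinct (suc i) (suc j) (s≤s i<j) j≤h p∣ with ℕₚ.m≤n⇒∃[o]m+o≡n i<j
    -- A difference of squares is the product of difference and sum; for distinct numbers between 1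
    -- and h both factors lie strictly between 0 and p.
    ... | d , refl = [ ∤-small (h<p (ℕₚ.≤-trans (s≤s (ℕₚ.m≤n⇒m≤1+n (ℕₚ.m≤n+m d i))) j≤h)) , ∤-small (s≤s (subst (_ ℕ.≤_) (sym (dbl≡+ h)) (ℕₚ.+-mono-≤ j≤h (ℕₚ.≤-trans (s≤s (ℕₚ.<⇒≤ i<j)) j≤h)))) ]′
        (euclidℤ pp (+ suc d) (+ (suc (suc (i ℕ.+ d)) ℕ.+ suc i)) (∣-cong (identity (+ i) (+ d)) p∣))
      where
      identity : ∀ i d → (+ 1 + (+ 1 + (i + d))) * (+ 1 + (+ 1 + (i + d))) - (+ 1 + i) * (+ 1 + i) ≡ (+ 1 + d) * (+ 1 + (+ 1 + (i + d)) + (+ 1 + i))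
      identity = solve-∀
    0^h : ∀ h → 3 < suc (dbl 0 h) → (+ 0) ^ h ≡ + 0
    0^h zero (s≤s ())
    0^h (suc h) _ = refl

  euler : ∀ a → ¬ + p ∣ a → (legendre a p ≡ + 1 ⊎ legendre a p ≡ - + 1) × + p ∣ a ^ h - legendre a p
  euler a p∤a with p ℕ∣.∣? ∣ a ∣
  ... | yes p∣a = ⊥-elim (p∤a (∣ᵤ⇒∣ p∣a))
  ... | no _ with any (λ x → ⌊ p ℕ∣.∣? ∣ (+ x) * (+ x) - a ∣ ⌋) (upTo p) in found
  ... | true with satisfied (any⁻ _ (upTo p) (subst IsTrue (sym found) _))
  ... | x , square = inj₁ refl , ∣-transfer′ {(+ x * + x) ^ h} {a ^ h} (power-∣ {x = + x * + x} {a} h p∣x²-a) (fermat-square x p∤x)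
    where
    p∣x²-a : + p ∣ + x * + x - a
    p∣x²-a = ∣ᵤ⇒∣ (toWitness square)
    p∤x : ¬ + p ∣ + x
    p∤x p∣x = p∤a (∣-combination (+ x) (- + 1) p∣x p∣x²-a (identity (+ x) a))
      where
      identity : ∀ x a → a ≡ x * x + - + 1 * (x * x - a)
      identity = solve-∀
    ∣-transfer′ : ∀ {y z} → + p ∣ y - z → + p ∣ y - + 1 → + p ∣ z - + 1
    ∣-transfer′ {y} {z} d e = ∣-combination (- + 1) (+ 1) d e (identity y z)
      where
      identity : ∀ y z → z - + 1 ≡ - + 1 * (y - z) + + 1 * (y - + 1)
      identity = solve-∀
  euler a p∤a | no _ | false = inj₂ refl , [ (λ p∣ → ⊥-elim (root-bound a nonsquare p∣)) , (λ p∣ → p∣) ]′ (square-root-of-1 a p∤a)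
    where
    nonsquare : ∀ x → x < p → ¬ + p ∣ + x * + x - a
    nonsquare x x<p p∣ = subst IsTrue found (any⁺ _ (lose (∈-upTo⁺ x<p) (fromWitness (∣⇒∣ᵤ p∣))))

  -- Trinomial coefficients modulo p and p²

  -- The integer with t p (k+1) / p = c k / (k+1), read off from the derivative of (1+x+1/x)^p.
  c : ℕ → ℤ
  c k = t n (+ k) - t n (+ suc (suc k))

  t-absorption : ∀ k → + suc k * t p (+ suc k) ≡ + p * c k
  t-absorption k = trans (t-derivative n (+ suc k)) (cong (λ x → + p * (t n (+ k) - t n x)) (suc-+1 k))

  t-∣ : ∀ k → suc k < p → + p ∣ t p (+ suc k)
  t-∣ k k<p = cancel-coprime pp (∤-small k<p) (divides (c k) (trans (t-absorption k) (ℤₚ.*-comm (+ p) (c k))))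

  -- Modulo p the coefficients of (1 + x + 1/x)^(p-1) satisfy the recurrence of χ, started from the top degree.
  t-χ : ∀ j k → j ℕ.+ k ≡ p → + p ∣ t n (+ k) - χ j
  t-χ 0 .p refl = ∣-cong (sym (cong (_- + 0) (t-vanishes (ℕₚ.n<1+n n)))) ∣0
  t-χ 1 k refl = ∣-cong (sym (cong (_- + 1) (t-diagonal k))) ∣0
  t-χ (suc (suc j)) k eq = ∣-cong (cong (λ x → t n (+ k) - x) (sym (χ-recurrence j)))
    (∣-combination (+ 1) (- + 1) (t-∣ k k+1<p)
      (∣-combination (+ 1) (+ 1) (t-χ (suc j) (suc k) eq₁) (t-χ j (suc (suc k)) eq₀) refl)
      (trans (identity (t n (+ k)) (t n (+ suc k)) (t n (+ suc (suc k))) (χ (suc j)) (χ j))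
        (cong (λ x → + 1 * x + - + 1 * (+ 1 * (t n (+ suc k) - χ (suc j)) + + 1 * (t n (+ suc (suc k)) - χ j))) (sym (t-suc n k)))))
    where
    eq₁ : suc j ℕ.+ suc k ≡ p
    eq₁ = trans (ℕₚ.+-suc (suc j) k) eq
    eq₀ : j ℕ.+ suc (suc k) ≡ p
    eq₀ = trans (ℕₚ.+-suc j (suc k)) eq₁
    k+1<p : suc k < p
    k+1<p = subst (suc k <_) eq₁ (s≤s (ℕₚ.m≤n+m (suc k) j))
    identity : ∀ a b c x y → a - (- x - y) ≡ + 1 * (a + b + c) + - + 1 * (+ 1 * (b - x) + + 1 * (c - y))
    identity = solve-∀

  -- The two coefficients in `c k` lie at distances i + 2 and i from exponent p, and `χ-difference`
  -- evaluates the difference of their residues.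
  c-w : ∀ i k → suc i ℕ.+ suc k ≡ p → + p ∣ c k - w (suc i)
  c-w i k eq = ∣-cong (cong (λ x → c k - x) (χ-difference i))
    (∣-combination (+ 1) (- + 1) (t-χ (suc (suc i)) k (trans (cong suc (sym (ℕₚ.+-suc i k))) eq)) (t-χ i (suc (suc k)) (trans (ℕₚ.+-suc i (suc k)) eq))
      (identity (t n (+ k)) (t n (+ suc (suc k))) (χ (suc (suc i))) (χ i)))
    where
    identity : ∀ a c x y → a - c - (x - y) ≡ + 1 * (a - x) + - + 1 * (c - y)
    identity = solve-∀

  c-g : ∀ k → suc k < p → + p ∣ c k - g h (suc k)
  c-g k k<p with ℕₚ.m≤n⇒∃[o]m+o≡n k<p
  ... | i , eq = ∣-cong (cong (λ x → c k - x) (trans (sym (w-dbl (suc i) (suc k))) (cong (λ x → w (dbl x (suc k))) eq′))) (c-w i k eq′)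
    where
    eq′ : suc i ℕ.+ suc k ≡ p
    eq′ = trans (ℕₚ.+-comm (suc i) (suc k)) (trans (ℕₚ.+-suc (suc k) i) eq)

  -- Both sides, multiplied by k + 1, are p times something known modulo p.
  t-binom : ∀ k → suc k < p → + p * + p ∣ t p (+ suc k) - sg k * g h (suc k) * binom p (suc k)
  t-binom k k<p = cancel-coprime² pp (∤-small k<p) (p²∣ inner (begin
      K * (t p K - s * G * binom p (suc k))                ≡⟨ identity₁ K (t p K) (s * G) (binom p (suc k)) ⟩
      K * t p K - s * G * (K * binom p (suc k))            ≡⟨ cong₂ (λ x y → x - s * G * y) (t-absorption k) (binom-absorption n k) ⟩
      -- Writing G as G s², allowed since s² = 1, splits the cofactor of p into multiples of c k - G
      -- and of C(p-1,k) - s, both zero modulo p.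
      + p * c k - s * G * (+ p * binom n k)                ≡⟨ identity₂ (+ p) (c k) s G (binom n k) ⟩
      (c k - G * (s * s) - s * G * (binom n k - s)) * + p  ≡⟨ cong (λ x → (c k - G * x - s * G * (binom n k - s)) * + p) (sg² k) ⟩
      (c k - G * + 1 - s * G * (binom n k - s)) * + p      ∎))
    where
    open ≡-Reasoning
    K = + suc k
    s = sg k
    G = g h (suc k)
    p²∣ : ∀ {x y} → + p ∣ x → y ≡ x * + p → + p * + p ∣ y
    p²∣ (divides q refl) eq = divides q (trans eq (ℤₚ.*-assoc q (+ p) (+ p)))
    inner : + p ∣ c k - G * + 1 - s * G * (binom n k - s)
    inner = ∣-combination (+ 1) (- (s * G)) (c-g k k<p) (binom-sg k (ℕₚ.<-trans (ℕₚ.n<1+n k) k<p)) (identity (c k) G s (binom n k))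
      where
      identity : ∀ c G s x → c - G * + 1 - s * G * (x - s) ≡ + 1 * (c - G) + - (s * G) * (x - s)
      identity = solve-∀
    identity₁ : ∀ K t x y → K * (t - x * y) ≡ K * t - x * (K * y)
    identity₁ = solve-∀
    identity₂ : ∀ p c s G x → p * c - s * G * (p * x) ≡ (c - G * (s * s) - s * G * (x - s)) * p
    identity₂ = solve-∀

  -- e is the weight under which the t p telescope, and e′ is the weight left after the sign of
  -- `t-binom` is absorbed.
  sum-t-binom : ∀ (e e′ : ℕ → ℤ) → (∀ k → e k * sg k ≡ e′ k) →
    + p * + p ∣ sum n (λ k → e k * t p (+ suc k)) - sum n (λ k → binom p (suc k) * (e′ k * g h (suc k)))
  sum-t-binom e e′ rel = ∣-cong (sum-diff n) (sum-∣ n (λ k k<n → ∣n⇒∣m*n (e k) (t-binom k (s≤s k<n))))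
    where
    identity : ∀ e t s G x → e * (t - s * G * x) ≡ e * t - x * (e * s * G)
    identity = solve-∀
    rearrange : ∀ a c x y → a - c + (x - y) ≡ a + x - (c + y)
    rearrange = solve-∀
    sum-diff : ∀ m → sum m (λ k → e k * (t p (+ suc k) - sg k * g h (suc k) * binom p (suc k))) ≡ sum m (λ k → e k * t p (+ suc k)) - sum m (λ k → binom p (suc k) * (e′ k * g h (suc k)))
    sum-diff zero = refl
    sum-diff (suc m) = trans (cong₂ _+_ (sum-diff m) (trans (identity (e m) (t p (+ suc m)) (sg m) (g h (suc m)) (binom p (suc m))) (cong (λ x → e m * t p (+ suc m) - binom p (suc m) * (x * g h (suc m))) (rel m))))
      (rearrange (sum m (λ k → e k * t p (+ suc k))) (sum m (λ k → binom p (suc k) * (e′ k * g h (suc k)))) (e m * t p (+ suc m)) (binom p (suc m) * (e′ m * g h (suc m))))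

  -- T 0 and T 1 in terms of X and Y

  3∤p : ¬ 3 ℕ∣.∣ p
  3∤p 3∣p = [ (λ ()) , (λ 3≡p → ℕₚ.<-irrefl 3≡p 3<p) ]′ (prime⇒irreducible pp 3∣p)

  g-end : g h p ≡ + 2
  g-end = w-dbl 0 p

  -- The term k = 0 vanishes because 1 has no imaginary part. The term k = p is (-1)^h times w at
  -- 3p, which is 2.
  Y-ends : Y h ≡ sum n (λ k → binom p (suc k) * (si (suc k) * g h (suc k))) + + 2 * sg h
  Y-ends = trans (W-ends (λ k → si k * g h k)) (trans (cong₂ (λ x y → + 0 * g h 0 + Σ + x * y) (co-dbl h) g-end) (identity (g h 0) Σ (sg h)))
    where
    Σ = sum n (λ k → binom p (suc k) * (si (suc k) * g h (suc k)))
    identity : ∀ a x s → + 0 * a + x + s * + 2 ≡ x + + 2 * s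
    identity = solve-∀

  -- For odd p the term k = p has no real part; the term k = 0 is `w p`, equal to -1 because 3 does
  -- not divide p.
  X-ends : X h ≡ sum n (λ k → binom p (suc k) * (co (suc k) * g h (suc k))) - + 1
  X-ends = trans (W-ends (λ k → co k * g h k)) (trans (cong₂ (λ x y → + 1 * x + Σ + - y * g h p) (w-∤ p 3∤p) (si-dbl h)) (identity Σ (g h p)))
    where
    Σ = sum n (λ k → binom p (suc k) * (co (suc k) * g h (suc k)))
    identity : ∀ x a → + 1 * - + 1 + x + - + 0 * a ≡ x - + 1
    identity = solve-∀

  Y-mod : + p ∣ Y h - + 2 * sg h
  Y-mod = ∣-cong (trans (identity (sum n (λ k → binom p (suc k) * (si (suc k) * g h (suc k)))) (sg h)) (cong (_- + 2 * sg h) (sym Y-ends)))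
    (sum-∣ n (λ k k<n → ∣m⇒∣m*n (si (suc k) * g h (suc k)) (binom-∣ k (s≤s k<n))))
    where
    identity : ∀ x s → x ≡ x + + 2 * s - + 2 * s
    identity = solve-∀

  X-mod : + p ∣ X h + + 1
  X-mod = ∣-cong (trans (identity (sum n (λ k → binom p (suc k) * (co (suc k) * g h (suc k))))) (cong (_+ + 1) (sym X-ends)))
    (sum-∣ n (λ k k<n → ∣m⇒∣m*n (co (suc k) * g h (suc k)) (binom-∣ k (s≤s k<n))))
    where
    identity : ∀ x → x ≡ x - + 1 + + 1
    identity = solve-∀

  -- Telescoping with the weights si isolates T 0 at the lower end. The upper end contributes
  -- -(-1)^h, through T (p-1) = 1.
  T₀-Y : + p * + p ∣ T p 0 - sg h - (Y h - + 2 * sg h)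
  T₀-Y = ∣-cong (cong₂ _-_ telescoped (trans (identity₁ _ (sg h)) (cong (_- + 2 * sg h) (sym Y-ends)))) (sum-t-binom (λ k → si (suc k)) (λ k → si (suc k)) (λ k → trans (ℤₚ.*-comm (co k) (sg k)) (proj₁ (sg-parity k))))
    where
    identity₁ : ∀ x s → x ≡ x + + 2 * s - + 2 * s
    identity₁ = solve-∀
    identity₂ : ∀ a s x y → (a * + 0 - s * + 1) - (+ 0 * x - + 1 * y) ≡ y - s
    identity₂ = solve-∀
    telescoped : sum n (λ k → si (suc k) * t p (+ suc k)) ≡ T p 0 - sg h
    telescoped = trans (T-telescope p n si (λ _ → refl)) (trans
      (cong (_- (+ 0 * T p 1 - + 1 * T p 0)) (cong₂ _-_ (cong (si n *_) (T-vanishes {p} ℕₚ.≤-refl)) (cong₂ _*_ (co-dbl h) (T-diagonal n))))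
      (identity₂ (si n) (sg h) (T p 1) (T p 0)))

  -- Telescoping with the weights co leaves only -T 1: at the upper end T p is 0 and the coefficient
  -- of T (p-1) is the real part of i^p, also 0.
  T₁-X : + p * + p ∣ T p 1 - (X h + + 1)
  T₁-X = ∣-multiple (- + 1) (sum-t-binom (λ k → co (suc k)) (λ k → si k) (λ k → trans (identity₁ (si k) (sg k)) (trans (cong -_ (proj₂ (sg-parity k))) (ℤₚ.neg-involutive (si k)))))
    (trans (cong (λ x → T p 1 - x) X+1) (trans (identity₂ (T p 1) Σ) (cong (λ x → - + 1 * (x - Σ)) (sym telescoped))))
    where
    Σ = sum n (λ k → binom p (suc k) * (si k * g h (suc k)))
    identity₁ : ∀ x s → - x * s ≡ - (s * x)
    identity₁ = solve-∀
    identity₂ : ∀ x y → x - - + 1 * y ≡ - + 1 * (- x - y)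
    identity₂ = solve-∀
    identity₃ : ∀ a x y → (a * + 0 - - + 0 * + 1) - (+ 1 * x - - + 0 * y) ≡ - x
    identity₃ = solve-∀
    identity₄ : ∀ x → x - + 1 + + 1 ≡ x
    identity₄ = solve-∀
    identity₅ : ∀ s x y z → - + 1 * s + x * (- y * z) ≡ - + 1 * (s + x * (y * z))
    identity₅ = solve-∀
    flip : ∀ m → sum m (λ k → binom p (suc k) * (co (suc k) * g h (suc k))) ≡ - + 1 * sum m (λ k → binom p (suc k) * (si k * g h (suc k)))
    flip zero = refl
    flip (suc m) = trans (cong (_+ binom p (suc m) * (- si m * g h (suc m))) (flip m)) (identity₅ (sum m (λ k → binom p (suc k) * (si k * g h (suc k)))) (binom p (suc m)) (si m) (g h (suc m)))
    X+1 : X h + + 1 ≡ - + 1 * Σ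
    X+1 = trans (cong (_+ + 1) X-ends) (trans (identity₄ _) (flip n))
    telescoped : sum n (λ k → co (suc k) * t p (+ suc k)) ≡ - T p 1
    telescoped = trans (T-telescope p n co (λ _ → refl)) (trans
      (cong (_- (+ 1 * T p 1 - - + 0 * T p 0)) (cong₂ _-_ (cong (co n *_) (T-vanishes {p} ℕₚ.≤-refl)) (cong₂ (λ x y → - x * y) (si-dbl h) (T-diagonal n))))
      (identity₃ (co n) (T p 1) (T p 0)))

  -- The Pell sequence modulo p² and the Legendre symbols

  -- Rational part of 2^h (1+√3)(2+√3)^h = (1+√3)^p ≡ 1 + 3^h √3; `√3-im-mod` is the irrational
  -- part.
  √3-re-mod : + p ∣ (+ 2) ^ h * (u h + + 3 * S h) - + 1
  √3-re-mod = ∣-cong (cong₂ _-_ (trans (W-√3-re-suc n) (trans (cong₂ (λ x y → x + + 3 * y) (proj₁ (W-√3 h)) (proj₂ (W-√3 h))) (identity ((+ 2) ^ h) (u h) (S h))))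
      (cong (λ x → + 1 + + 3 * x) (√3-im-dbl h))) (W-mod √3-re)
    where
    identity : ∀ e u S → e * u + + 3 * (e * S) ≡ e * (u + + 3 * S)
    identity = solve-∀

  √3-im-mod : + p ∣ (+ 2) ^ h * (u h + S h) - (+ 3) ^ h
  √3-im-mod = ∣-cong (cong₂ _-_ (trans (cong₂ _+_ (proj₂ (W-√3 h)) (proj₁ (W-√3 h))) (identity ((+ 2) ^ h) (u h) (S h)))
      (trans (ℤₚ.+-identityˡ _) (√3-re-dbl h))) (W-mod √3-im)
    where
    identity : ∀ e u S → e * S + e * u ≡ e * (u + S)
    identity = solve-∀

  sign-unique : ∀ {x y} → IsSign x → IsSign y → + p ∣ x - y → x ≡ y
  sign-unique (inj₁ refl) (inj₁ refl) _ = refl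
  sign-unique (inj₁ refl) (inj₂ refl) p∣2 = ⊥-elim (∤2 p∣2)
  sign-unique (inj₂ refl) (inj₁ refl) p∣-2 = ⊥-elim (∤2 (∣-multiple (- + 1) p∣-2 refl))
  sign-unique (inj₂ refl) (inj₂ refl) _ = refl

  -- (U-1)(U+1) = 3V² is a multiple of p², and U + 1 ≡ 2 is prime to p.
  pell-lift : ∀ {U V} → U * U ≡ + 1 + + 3 * (V * V) → + p ∣ V → + p ∣ U - + 1 → + p * + p ∣ U - + 1
  pell-lift {U} {V} norm (divides q refl) p∣U-1 = cancel-coprime² pp {U + + 1} (λ p∣U+1 → ∤2 (∣-combination (+ 1) (- + 1) p∣U+1 p∣U-1 (identity₁ U)))
    (divides (+ 3 * (q * q)) (trans (identity₂ U) (trans (cong (_- + 1) norm) (identity₃ q (+ p)))))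
    where
    identity₁ : ∀ U → + 2 ≡ + 1 * (U + + 1) + - + 1 * (U - + 1)
    identity₁ = solve-∀
    identity₂ : ∀ U → (U + + 1) * (U - + 1) ≡ U * U - + 1
    identity₂ = solve-∀
    identity₃ : ∀ q p → + 1 + + 3 * (q * p * (q * p)) - + 1 ≡ + 3 * (q * q) * (p * p)
    identity₃ = solve-∀

  -- The residues of X and Y force U + V√3 ≡ 1; the two components of (1+√3)^p then give E and F,
  -- which stand for ±2^h and 3^h.
  split-case : ∀ U V E F → U * U ≡ + 1 + + 3 * (V * V) →
    + p ∣ - U + + 1 → + p ∣ + 2 * U + + 3 * V - + 2 → + p ∣ E * (U + + 3 * V) - + 1 → + p ∣ E * (U + V) - F →
    (+ p ∣ E - + 1) × (+ p ∣ F - + 1) × (+ p * + p ∣ U - + 1)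
  split-case U V E F norm pX pY pE pF = E≡1 , F≡1 , pell-lift {U} {V} norm V≡0 U≡1
    where
    U≡1 : + p ∣ U - + 1
    U≡1 = ∣-multiple (- + 1) pX (identity U)
      where
      identity : ∀ U → U - + 1 ≡ - + 1 * (- U + + 1)
      identity = solve-∀
    V≡0 : + p ∣ V
    V≡0 = cancel-coprime pp ∤3 (∣-combination (+ 1) (- + 2) pY U≡1 (identity U V))
      where
      identity : ∀ U V → + 3 * V ≡ + 1 * (+ 2 * U + + 3 * V - + 2) + - + 2 * (U - + 1)
      identity = solve-∀
    E≡1 : + p ∣ E - + 1
    E≡1 = ∣-combination (+ 1) (- E) pE (∣-combination (+ 1) (+ 3) U≡1 V≡0 refl) (identity U V E)
      where
      identity : ∀ U V E → E - + 1 ≡ + 1 * (E * (U + + 3 * V) - + 1) + - E * (+ 1 * (U - + 1) + + 3 * V)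
      identity = solve-∀
    F≡1 : + p ∣ F - + 1
    F≡1 = ∣-combination (+ 1) E (∣-combination (- + 1) (+ 1) pF E≡1 refl) (∣-combination (+ 1) (+ 1) U≡1 V≡0 refl) (identity U V E F)
      where
      identity : ∀ U V E F → F - + 1 ≡ + 1 * (- + 1 * (E * (U + V) - F) + + 1 * (E - + 1)) + E * (+ 1 * (U - + 1) + + 1 * V)
      identity = solve-∀

  -- Here U + V√3 ≡ 2 - √3, the inverse of 2 + √3. Multiplying by 2 + √3 moves to index h + 1 and
  -- gives the pair (2U+3V, U+2V) ≡ (1,0), to which `pell-lift` applies.
  inert-case : ∀ U V E F → U * U ≡ + 1 + + 3 * (V * V) →
    + p ∣ - (+ 2 * U + + 3 * V) + + 1 → + p ∣ U - + 2 → + p ∣ E * (U + + 3 * V) - + 1 → + p ∣ E * (U + V) - F →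
    (+ p ∣ E - - + 1) × (+ p ∣ F - - + 1) × (+ p * + p ∣ + 2 * U + + 3 * V - + 1)
  inert-case U V E F norm pX pY pE pF = E≡-1 , F≡-1 , pell-lift {+ 2 * U + + 3 * V} {U + + 2 * V} norm′ V′≡0 U′≡1
    where
    U′≡1 : + p ∣ + 2 * U + + 3 * V - + 1
    U′≡1 = ∣-multiple (- + 1) pX (identity U V)
      where
      identity : ∀ U V → + 2 * U + + 3 * V - + 1 ≡ - + 1 * (- (+ 2 * U + + 3 * V) + + 1)
      identity = solve-∀
    V≡-1 : + p ∣ V + + 1
    V≡-1 = cancel-coprime pp ∤3 (∣-combination (+ 1) (- + 2) U′≡1 pY (identity U V))
      where
      identity : ∀ U V → + 3 * (V + + 1) ≡ + 1 * (+ 2 * U + + 3 * V - + 1) + - + 2 * (U - + 2)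
      identity = solve-∀
    V′≡0 : + p ∣ U + + 2 * V
    V′≡0 = ∣-combination (+ 1) (+ 2) pY V≡-1 (identity U V)
      where
      identity : ∀ U V → U + + 2 * V ≡ + 1 * (U - + 2) + + 2 * (V + + 1)
      identity = solve-∀
    norm′ : (+ 2 * U + + 3 * V) * (+ 2 * U + + 3 * V) ≡ + 1 + + 3 * ((U + + 2 * V) * (U + + 2 * V))
    norm′ = trans (identity₁ U V) (trans (cong (λ x → x + (+ 3 * (U * U) + + 12 * (U * V) + + 9 * (V * V))) norm) (identity₂ U V))
      where
      identity₁ : ∀ U V → (+ 2 * U + + 3 * V) * (+ 2 * U + + 3 * V) ≡ U * U + (+ 3 * (U * U) + + 12 * (U * V) + + 9 * (V * V))
      identity₁ = solve-∀
      identity₂ : ∀ U V → + 1 + + 3 * (V * V) + (+ 3 * (U * U) + + 12 * (U * V) + + 9 * (V * V)) ≡ + 1 + + 3 * ((U + + 2 * V) * (U + + 2 * V))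
      identity₂ = solve-∀
    E≡-1 : + p ∣ E - - + 1
    E≡-1 = ∣-combination (- + 1) E pE (∣-combination (+ 1) (+ 3) pY V≡-1 refl) (identity U V E)
      where
      identity : ∀ U V E → E - - + 1 ≡ - + 1 * (E * (U + + 3 * V) - + 1) + E * (+ 1 * (U - + 2) + + 3 * (V + + 1))
      identity = solve-∀
    F≡-1 : + p ∣ F - - + 1
    F≡-1 = ∣-combination (+ 1) E (∣-combination (- + 1) (+ 1) pF E≡-1 refl) (∣-combination (+ 1) (+ 1) pY V≡-1 refl) (identity U V E F)
      where
      identity : ∀ U V E F → F - - + 1 ≡ + 1 * (- + 1 * (E * (U + V) - F) + + 1 * (E - - + 1)) + E * (+ 1 * (U - + 2) + + 1 * (V + + 1))
      identity = solve-∀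

  index : ℤ → ℕ
  index ε = ∣ + p - ε ∣ ℕ./ 2

  index-1 : index (+ 1) ≡ h
  index-1 = trans (cong (ℕ._/ 2) (dbl≡*2 h)) (m*n/n≡m h 2)

  index-neg1 : index (- + 1) ≡ suc h
  index-neg1 = trans (cong (ℕ._/ 2) (trans (ℕₚ.+-comm p 1) (dbl≡*2 (suc h)))) (m*n/n≡m (suc h) 2)

  XY-lift : ∀ {x y κ λ₃ λ₋₂} → + p ∣ x + + 1 → + p ∣ y - + 2 * sg h → IsSign κ →
    ((x ≡ - (sg h * κ * u h) × y ≡ κ * (+ 2 * u h + + 3 * S h)) ⊎ (x ≡ - (sg h * κ * (+ 2 * u h + + 3 * S h)) × y ≡ κ * u h)) →
    IsSign λ₃ → + p ∣ (+ 3) ^ h - λ₃ → IsSign λ₋₂ → + p ∣ (- + 2) ^ h - λ₋₂ →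
    (+ p * + p ∣ x + + 1) × (+ p * + p ∣ y - (+ 2 * sg h + + 3 * λ₋₂ * S (index λ₃)))
  XY-lift {x} {y} {κ} {λ₃} {λ₋₂} x-mod y-mod κ±1 shape λ₃±1 euler₃ λ₋₂±1 euler₋₂ = result shape
    where
    η = sg h
    μ = η * κ
    μ±1 : IsSign μ
    μ±1 = IsSign-* (IsSign-sg h) κ±1
    μ²≡1 : μ * μ ≡ + 1
    μ²≡1 = IsSign-square μ±1
    κ≡ημ : κ ≡ η * μ
    κ≡ημ = sym (trans (sym (ℤₚ.*-assoc η η κ)) (trans (cong (_* κ) (sg² h)) (ℤₚ.*-identityˡ κ)))
    U = μ * u h
    V = μ * S h
    -- The extra μ meets the one in U and V, and μ² = 1 keeps the congruences for (1+√3)^p intact.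
    E = (+ 2) ^ h * μ
    F = (+ 3) ^ h
    norm : U * U ≡ + 1 + + 3 * (V * V)
    norm = trans (identity₁ μ (u h)) (trans (cong₂ _*_ μ²≡1 (pell h)) (trans (identity₂ (S h)) (trans (cong (λ x → + 1 + + 3 * (x * (S h * S h))) (sym μ²≡1)) (identity₃ μ (S h)))))
      where
      identity₁ : ∀ m u → m * u * (m * u) ≡ m * m * (u * u)
      identity₁ = solve-∀
      identity₂ : ∀ S → + 1 * (+ 1 + + 3 * (S * S)) ≡ + 1 + + 3 * (+ 1 * (S * S))
      identity₂ = solve-∀
      identity₃ : ∀ m S → + 1 + + 3 * (m * m * (S * S)) ≡ + 1 + + 3 * (m * S * (m * S))
      identity₃ = solve-∀
    pE : + p ∣ E * (U + + 3 * V) - + 1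
    pE = ∣-cong (cong (_- + 1) (sym (trans (identity₁ ((+ 2) ^ h) μ (u h) (S h)) (trans (cong (_* ((+ 2) ^ h * (u h + + 3 * S h))) μ²≡1) (ℤₚ.*-identityˡ ((+ 2) ^ h * (u h + + 3 * S h))))))) √3-re-mod
      where
      identity₁ : ∀ e m u S → e * m * (m * u + + 3 * (m * S)) ≡ m * m * (e * (u + + 3 * S))
      identity₁ = solve-∀
    pF : + p ∣ E * (U + V) - F
    pF = ∣-cong (cong (_- F) (sym (trans (identity₁ ((+ 2) ^ h) μ (u h) (S h)) (trans (cong (_* ((+ 2) ^ h * (u h + S h))) μ²≡1) (ℤₚ.*-identityˡ ((+ 2) ^ h * (u h + S h))))))) √3-im-mod
      where
      identity₁ : ∀ e m u S → e * m * (m * u + m * S) ≡ m * m * (e * (u + S))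
      identity₁ = solve-∀
    pηY : + p ∣ η * y - + 2
    pηY = ∣-cong (trans (identity₁ η (y)) (cong (λ x → η * y - + 2 * x) (sg² h))) (∣n⇒∣m*n η y-mod)
      where
      identity₁ : ∀ s y → s * (y - + 2 * s) ≡ s * y - + 2 * (s * s)
      identity₁ = solve-∀
    finish : ∀ {δ l} → IsSign δ → + p ∣ E - δ → + p ∣ F - δ → index δ ≡ l →
      + p * + p ∣ y - (+ 2 * η + + 3 * (η * μ * δ) * S l) → + p * + p ∣ y - (+ 2 * η + + 3 * λ₋₂ * S (index λ₃))
    finish {δ} δ±1 E≡δ F≡δ refl = subst (λ x → + p * + p ∣ y - x) (cong₂ (λ x y → + 2 * η + + 3 * x * S (index y)) (sym λ₋₂≡) (sym λ₃≡))
      where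
      λ₃≡ : λ₃ ≡ δ
      λ₃≡ = sign-unique λ₃±1 δ±1 (∣-combination (- + 1) (+ 1) euler₃ F≡δ (identity λ₃ δ F))
        where
        identity : ∀ l d F → l - d ≡ - + 1 * (F - l) + + 1 * (F - d)
        identity = solve-∀
      -- (-2)^h = η 2^h = η μ E because μ² = 1, and E ≡ δ.
      λ₋₂≡ : λ₋₂ ≡ η * μ * δ
      λ₋₂≡ = sign-unique λ₋₂±1 (IsSign-* (IsSign-* (IsSign-sg h) μ±1) δ±1)
        (∣-combination (- + 1) (η * μ) euler₋₂ E≡δ (trans (identity₁ λ₋₂ η ((+ 2) ^ h) μ δ)
          (trans (cong (λ x → - + 1 * (η * (+ 2) ^ h * x - λ₋₂) + η * μ * (E - δ)) μ²≡1)
            (cong (λ x → - + 1 * (x - λ₋₂) + η * μ * (E - δ)) (trans (ℤₚ.*-identityʳ (η * (+ 2) ^ h)) (sym (power-neg2 h)))))))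
        where
        identity₁ : ∀ l s e m d → l - s * m * d ≡ - + 1 * (s * e * (m * m) - l) + s * m * (e * m - d)
        identity₁ = solve-∀
    result : ((x ≡ - (μ * u h) × y ≡ κ * (+ 2 * u h + + 3 * S h)) ⊎ (x ≡ - (μ * (+ 2 * u h + + 3 * S h)) × y ≡ κ * u h)) →
      (+ p * + p ∣ x + + 1) × (+ p * + p ∣ y - (+ 2 * η + + 3 * λ₋₂ * S (index λ₃)))
    result (inj₁ (x≡ , y≡)) = ∣-multiple (- + 1) U≡1 (trans (cong (_+ + 1) x≡) (identity₁ U)) ,
        finish (inj₁ refl) (proj₁ split) (proj₁ (proj₂ split)) index-1
          -- The S terms cancel exactly and leave 2η(U-1), so S need not be known modulo p².
          (∣-multiple (+ 2 * η) U≡1 (trans (cong (_- (+ 2 * η + + 3 * (η * μ * + 1) * S h)) (trans y≡ (cong (_* (+ 2 * u h + + 3 * S h)) κ≡ημ))) (identity₂ η μ (u h) (S h))))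
      where
      ηy≡ : η * y ≡ + 2 * U + + 3 * V
      ηy≡ = trans (cong (η *_) y≡) (identity η κ (u h) (S h))
        where
        identity : ∀ s k u S → s * (k * (+ 2 * u + + 3 * S)) ≡ + 2 * (s * k * u) + + 3 * (s * k * S)
        identity = solve-∀
      split : (+ p ∣ E - + 1) × (+ p ∣ F - + 1) × (+ p * + p ∣ U - + 1)
      split = split-case U V E F norm (∣-cong (cong (_+ + 1) x≡) x-mod) (∣-cong (cong (_- + 2) ηy≡) pηY) pE pF
      U≡1 : + p * + p ∣ U - + 1
      U≡1 = proj₂ (proj₂ split)
      identity₁ : ∀ U → - U + + 1 ≡ - + 1 * (U - + 1)
      identity₁ = solve-∀
      identity₂ : ∀ s m u S → s * m * (+ 2 * u + + 3 * S) - (+ 2 * s + + 3 * (s * m * + 1) * S) ≡ + 2 * s * (m * u - + 1)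
      identity₂ = solve-∀
    result (inj₂ (x≡ , y≡)) = ∣-multiple (- + 1) U′≡1 (trans (cong (_+ + 1) x≡′) (identity₁ (+ 2 * U + + 3 * V))) ,
        finish (inj₂ refl) (proj₁ inert) (proj₁ (proj₂ inert)) index-neg1
          -- Expanding S at h + 1 as u + 2S makes the difference exactly 2η(2U+3V-1).
          (∣-multiple (+ 2 * η) U′≡1 (trans (cong₂ (λ y z → y - (+ 2 * η + + 3 * (η * μ * - + 1) * z)) (trans y≡ (cong (_* u h) κ≡ημ)) (S-suc h)) (identity₂ η μ (u h) (S h))))
      where
      x≡′ : x ≡ - (+ 2 * U + + 3 * V)
      x≡′ = trans x≡ (identity μ (u h) (S h))
        where
        identity : ∀ m u S → - (m * (+ 2 * u + + 3 * S)) ≡ - (+ 2 * (m * u) + + 3 * (m * S))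
        identity = solve-∀
      ηy≡ : η * y ≡ U
      ηy≡ = trans (cong (η *_) y≡) (sym (ℤₚ.*-assoc η κ (u h)))
      inert : (+ p ∣ E - - + 1) × (+ p ∣ F - - + 1) × (+ p * + p ∣ + 2 * U + + 3 * V - + 1)
      inert = inert-case U V E F norm (∣-cong (cong (_+ + 1) x≡′) x-mod) (∣-cong (cong (_- + 2) ηy≡) pηY) pE pF
      U′≡1 : + p * + p ∣ + 2 * U + + 3 * V - + 1
      U′≡1 = proj₂ (proj₂ inert)
      identity₁ : ∀ U → - U + + 1 ≡ - + 1 * (U - + 1)
      identity₁ = solve-∀
      identity₂ : ∀ s m u S → s * m * u - (+ 2 * s + + 3 * (s * m * - + 1) * (u + + 2 * S)) ≡ + 2 * s * (+ 2 * (m * u) + + 3 * (m * S) - + 1)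
      identity₂ = solve-∀

  T-mod² : (+ p * + p ∣ T p 1) × (+ p * + p ∣ T p 0 - sg h - + 3 * legendre (- + 2) p * S (index (legendre (+ 3) p)))
  T-mod² = combine (XY-lift {X h} {Y h} X-mod Y-mod (proj₁ (proj₂ shape)) (proj₂ (proj₂ shape)) (proj₁ euler₃) (proj₂ euler₃) (proj₁ euler₋₂) (proj₂ euler₋₂))
    where
    shape = XY-shape h 3∤p
    euler₃ = euler (+ 3) ∤3
    euler₋₂ = euler (- + 2) (λ p∣-2 → ∤2 (∣-multiple (- + 1) p∣-2 refl))
    identity : ∀ t s y z → t - s - z ≡ + 1 * (t - s - (y - + 2 * s)) + + 1 * (y - (+ 2 * s + z))
    identity = solve-∀
    combine : ∀ {z} → (+ p * + p ∣ X h + + 1) × (+ p * + p ∣ Y h - (+ 2 * sg h + z)) → (+ p * + p ∣ T p 1) × (+ p * + p ∣ T p 0 - sg h - z)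
    combine {z} (x , y) = ∣-transfer {x = T p 1} {X h + + 1} T₁-X x , ∣-combination (+ 1) (+ 1) T₀-Y y (identity (T p 0) (sg h) (Y h) z)

  -- Rational congruences by induction on d

  open Integral pp

  rp : ℚ
  rp = recip p

  Integral-recip : ∀ {k} → suc k < p → Integral (recip (suc k))
  Integral-recip {k} k<p = Integral-/ (+ 1) (suc k) (ℕ∣.>⇒∤ k<p)

  Integral-sgn : ∀ k → Integral (sgn k)
  Integral-sgn k = subst Integral (ι-sg k) (Integral-ι (sg k))

  mod²⇒≈0 : ∀ {z} → + p * + p ∣ z → ι z ℚ.* rp ≈ 0ℚ
  mod²⇒≈0 (divides q refl) = congruent (subst Integral (sym (begin
      (ι (q * (+ p * + p)) ℚ.* rp ℚ.- 0ℚ) ℚ.* rp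
        ≡⟨ cong (λ x → (x ℚ.* rp ℚ.- 0ℚ) ℚ.* rp) (trans (ι-* q (+ p * + p)) (cong (ι q ℚ.*_) (ι-* (+ p) (+ p)))) ⟩
      (ι q ℚ.* (ι (+ p) ℚ.* ι (+ p)) ℚ.* rp ℚ.- 0ℚ) ℚ.* rp
        ≡⟨ solve 3 (λ q p r → (q :* (p :* p) :* r :- con 0ℚ) :* r := q :* ((p :* r) :* (p :* r))) refl (ι q) (ι (+ p)) rp ⟩
      ι q ℚ.* ((ι (+ p) ℚ.* rp) ℚ.* (ι (+ p) ℚ.* rp))
        ≡⟨ cong (λ x → ι q ℚ.* (x ℚ.* x)) (ι-recip n) ⟩
      ι q ℚ.* (1ℚ ℚ.* 1ℚ)
        ≡⟨ ℚₚ.*-identityʳ (ι q) ⟩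
      ι q ∎)) (Integral-ι q))
    where open ≡-Reasoning

  -- The left side equals c k / (k+1) exactly; c k is known modulo p, and k + 1 < p makes 1/(k+1)
  -- integral.
  t-≈ : ∀ k → suc k < p → ι (t p (+ suc k)) ℚ.* rp ≈ ι (g h (suc k)) ℚ.* recip (suc k)
  t-≈ k k<p with c-g k k<p
  ... | divides q c-g≡qp = congruent (subst Integral (sym (begin
      (ι τ ℚ.* rp ℚ.- ι G ℚ.* r) ℚ.* rp
        ≡⟨ cong (λ x → (x ℚ.- ι G ℚ.* r) ℚ.* rp) tp≡cr ⟩
      (ι (c k) ℚ.* r ℚ.- ι G ℚ.* r) ℚ.* rp
        ≡⟨ solve 4 (λ c G r rp → (c :* r :- G :* r) :* rp := (c :- G) :* rp :* r) refl (ι (c k)) (ι G) r rp ⟩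
      (ι (c k) ℚ.- ι G) ℚ.* rp ℚ.* r
        ≡⟨ cong (λ x → x ℚ.* rp ℚ.* r) (trans (sym (ι-sub (c k) G)) (trans (cong ι c-g≡qp) (ι-* q (+ p)))) ⟩
      ι q ℚ.* ι (+ p) ℚ.* rp ℚ.* r
        ≡⟨ solve 4 (λ q p rp r → q :* p :* rp :* r := q :* (p :* rp) :* r) refl (ι q) (ι (+ p)) rp r ⟩
      ι q ℚ.* (ι (+ p) ℚ.* rp) ℚ.* r
        ≡⟨ cong (λ x → ι q ℚ.* x ℚ.* r) (ι-recip n) ⟩
      ι q ℚ.* 1ℚ ℚ.* r
        ≡⟨ cong (ℚ._* r) (ℚₚ.*-identityʳ (ι q)) ⟩
      ι q ℚ.* r ∎)) (Integral-* (Integral-ι q) (Integral-recip k<p)))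
    where
    open ≡-Reasoning
    r = recip (suc k)
    K = ι (+ suc k)
    G = g h (suc k)
    τ = t p (+ suc k)
    tp≡cr : ι τ ℚ.* rp ≡ ι (c k) ℚ.* r
    tp≡cr = begin
      ι τ ℚ.* rp
        ≡⟨ sym (ℚₚ.*-identityˡ (ι τ ℚ.* rp)) ⟩
      1ℚ ℚ.* (ι τ ℚ.* rp)
        ≡⟨ cong (ℚ._* (ι τ ℚ.* rp)) (sym (ι-recip k)) ⟩
      K ℚ.* r ℚ.* (ι τ ℚ.* rp)
        ≡⟨ solve 4 (λ K r t rp → K :* r :* (t :* rp) := (K :* t) :* (r :* rp)) refl K r (ι τ) rp ⟩
      (K ℚ.* ι τ) ℚ.* (r ℚ.* rp)
        ≡⟨ cong (ℚ._* (r ℚ.* rp)) (trans (sym (ι-* (+ suc k) τ)) (trans (cong ι (t-absorption k)) (ι-* (+ p) (c k)))) ⟩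
      ι (+ p) ℚ.* ι (c k) ℚ.* (r ℚ.* rp)
        ≡⟨ solve 4 (λ p c r rp → p :* c :* (r :* rp) := (p :* rp) :* (c :* r)) refl (ι (+ p)) (ι (c k)) r rp ⟩
      (ι (+ p) ℚ.* rp) ℚ.* (ι (c k) ℚ.* r)
        ≡⟨ cong (ℚ._* (ι (c k) ℚ.* r)) (ι-recip n) ⟩
      1ℚ ℚ.* (ι (c k) ℚ.* r)
        ≡⟨ ℚₚ.*-identityˡ (ι (c k) ℚ.* r) ⟩
      ι (c k) ℚ.* r ∎

  ι-T-recurrence : ∀ d → ι (T p (suc (suc d))) ≡ ι (t p (+ suc d)) ℚ.- ι (T p d)
  ι-T-recurrence d = trans (cong ι (trans (identity (T p d) (T p (suc (suc d)))) (cong (_- T p d) (T-recurrence p d)))) (ι-sub (t p (+ suc d)) (T p d))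
    where
    identity : ∀ x y → y ≡ x + y - x
    identity = solve-∀

  oddTerm oddTerm₃ : ℕ → ℚ
  oddTerm k = sgn (suc k) ℚ.* recip (suc k)
  oddTerm₃ k = if ⌊ 3 ℕ∣.∣? (suc k ℕ.+ p) ⌋ then oddTerm k else 0ℚ

  -- As w is 2 on multiples of 3 and -1 elsewhere, a sum weighted by -w is the plain sum minus three
  -- times its part over multiples of 3.
  oddR : ℕ → ℚ
  oddR m = (sgn (suc m) ℚ.* (+ 1 / 2)) ℚ.* (sumBelow m oddTerm ℚ.- (+ 3 / 1) ℚ.* sumBelow m oddTerm₃)

  oddR-suc : ∀ m → oddR (suc m) ≡ ι (g h (dbl 0 (suc m))) ℚ.* recip (dbl 0 (suc m)) ℚ.+ (ι (- + 1)) ℚ.* oddR m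
  oddR-suc m with 3 ℕ∣.∣? (suc m ℕ.+ p)
  ... | yes 3∣ = begin
      _ ≡⟨ solve 4 (λ s A B r → (:- s :* con (+ 1 / 2)) :* ((A :+ s :* r) :- con (+ 3 / 1) :* (B :+ s :* r))
             := (s :* s) :* r :+ con (ι (- + 1)) :* ((s :* con (+ 1 / 2)) :* (A :- con (+ 3 / 1) :* B))) refl s A B r ⟩
      (s ℚ.* s) ℚ.* r ℚ.+ R′ ≡⟨ cong (λ x → x ℚ.* r ℚ.+ R′) (sgn² (suc m)) ⟩
      1ℚ ℚ.* r ℚ.+ R′ ≡⟨ cong (ℚ._+ R′) (solve 1 (λ r → con 1ℚ :* r := con (ι (+ 2)) :* (con (+ 1 / 2) :* r)) refl r) ⟩
      ι (+ 2) ℚ.* ((+ 1 / 2) ℚ.* r) ℚ.+ R′ ≡⟨ cong₂ (λ x y → ι x ℚ.* y ℚ.+ R′) (sym (trans g≡w (w-∣ (suc m ℕ.+ p) 3∣))) (sym (recip-dbl m)) ⟩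
      ι (g h (dbl 0 (suc m))) ℚ.* recip (dbl 0 (suc m)) ℚ.+ R′ ∎
    where
    open ≡-Reasoning
    s = sgn (suc m)
    A = sumBelow m oddTerm
    B = sumBelow m oddTerm₃
    r = recip (suc m)
    R′ = ι (- + 1) ℚ.* oddR m
    g≡w : g h (dbl 0 (suc m)) ≡ w (suc m ℕ.+ p)
    g≡w = periodic-p+4m w (λ _ → refl) p (suc m)
  ... | no 3∤ = begin
      _ ≡⟨ solve 4 (λ s A B r → (:- s :* con (+ 1 / 2)) :* ((A :+ s :* r) :- con (+ 3 / 1) :* (B :+ con 0ℚ))
             := con (ι (- + 1)) :* ((s :* s) :* (con (+ 1 / 2) :* r)) :+ con (ι (- + 1)) :* ((s :* con (+ 1 / 2)) :* (A :- con (+ 3 / 1) :* B))) refl s A B r ⟩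
      ι (- + 1) ℚ.* ((s ℚ.* s) ℚ.* ((+ 1 / 2) ℚ.* r)) ℚ.+ R′ ≡⟨ cong (λ x → ι (- + 1) ℚ.* (x ℚ.* ((+ 1 / 2) ℚ.* r)) ℚ.+ R′) (sgn² (suc m)) ⟩
      ι (- + 1) ℚ.* (1ℚ ℚ.* ((+ 1 / 2) ℚ.* r)) ℚ.+ R′ ≡⟨ cong (λ x → ι (- + 1) ℚ.* x ℚ.+ R′) (ℚₚ.*-identityˡ ((+ 1 / 2) ℚ.* r)) ⟩
      ι (- + 1) ℚ.* ((+ 1 / 2) ℚ.* r) ℚ.+ R′ ≡⟨ cong₂ (λ x y → ι x ℚ.* y ℚ.+ R′) (sym (trans g≡w (w-∤ (suc m ℕ.+ p) 3∤))) (sym (recip-dbl m)) ⟩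
      ι (g h (dbl 0 (suc m))) ℚ.* recip (dbl 0 (suc m)) ℚ.+ R′ ∎
    where
    open ≡-Reasoning
    s = sgn (suc m)
    A = sumBelow m oddTerm
    B = sumBelow m oddTerm₃
    r = recip (suc m)
    R′ = ι (- + 1) ℚ.* oddR m
    g≡w : g h (dbl 0 (suc m)) ≡ w (suc m ℕ.+ p)
    g≡w = periodic-p+4m w (λ _ → refl) p (suc m)

  odd-≈ : ∀ m → suc (dbl 0 m) < p → ι (T p (suc (dbl 0 m))) ℚ.* rp ≈ oddR m
  -- `oddR 0` evaluates to 0, both sums being empty.
  odd-≈ zero _ = mod²⇒≈0 (proj₁ T-mod²)
  odd-≈ (suc m) d<p = subst₂ _≈_
      (sym (trans (cong (ℚ._* rp) (ι-T-recurrence d)) (solve 3 (λ x y r → (x :- y) :* r := x :* r :+ con (ι (- + 1)) :* (y :* r)) refl (ι (t p (+ suc d))) (ι (T p d)) rp)))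
      (sym (oddR-suc m))
      (≈-affine (ι (- + 1)) (Integral-ι (- + 1)) (t-≈ d d+1<p) (odd-≈ m (ℕₚ.<-trans (ℕₚ.n<1+n d) d+1<p)))
    where
    d = suc (dbl 0 m)
    d+1<p : suc d < p
    d+1<p = ℕₚ.<-trans (ℕₚ.n<1+n (suc d)) d<p

  evenTerm evenTerm₃ : ℕ → ℚ
  evenTerm j = sgn j ℚ.* recip (2 ℕ.* j ℕ.+ 1)
  evenTerm₃ j = if not ⌊ 3 ℕ∣.∣? (p ∸ (2 ℕ.* j ℕ.+ 1)) ⌋ then evenTerm j else 0ℚ

  2m+1≡ : ∀ m → 2 ℕ.* m ℕ.+ 1 ≡ suc (dbl 0 m)
  2m+1≡ m = trans (ℕₚ.+-comm (2 ℕ.* m) 1) (cong suc (trans (ℕₚ.*-comm 2 m) (sym (dbl≡*2 m))))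

  -- The truncated subtraction is exact because k < p; this matches g with the divisibility test in
  -- the even case.
  g-∸ : ∀ {k j} → k < p → j ≡ k → g h k ≡ w (p ∸ j)
  g-∸ {k} k<p refl = trans (cong (λ x → w (dbl x k)) (sym (ℕₚ.m∸n+n≡m (ℕₚ.<⇒≤ k<p)))) (w-dbl (p ∸ k) k)

  module _ (z : ℤ) where

    -- z stands for the residue of T 0 - (-1)^h modulo p². The coefficients -2 and 3 encode -w, now
    -- split along the non-multiples of 3.
    evenL evenR : ℕ → ℚ
    evenL m = (sgn m ℚ.* ι (T p (dbl 0 m)) ℚ.- sgn h) ℚ.* rp
    evenR m = ι z ℚ.* rp ℚ.- (+ 2 / 1) ℚ.* sumBelow m evenTerm ℚ.+ (+ 3 / 1) ℚ.* sumBelow m evenTerm₃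

    evenR-suc : ∀ m → suc (dbl 0 m) < p → evenR (suc m) ≡ evenR m ℚ.+ sgn (suc m) ℚ.* (ι (g h (suc (dbl 0 m))) ℚ.* recip (suc (dbl 0 m)))
    evenR-suc m d<p with 3 ℕ∣.∣? (p ∸ (2 ℕ.* m ℕ.+ 1))
    ... | yes 3∣ = begin
        _ ≡⟨ solve 5 (λ z A B s r → z :- con (+ 2 / 1) :* (A :+ s :* r) :+ con (+ 3 / 1) :* (B :+ con 0ℚ)
               := z :- con (+ 2 / 1) :* A :+ con (+ 3 / 1) :* B :+ :- s :* (con (ι (+ 2)) :* r)) refl (ι z ℚ.* rp) A B (sgn m) r ⟩
        evenR m ℚ.+ sgn (suc m) ℚ.* (ι (+ 2) ℚ.* r) ≡⟨ cong₂ (λ x y → evenR m ℚ.+ sgn (suc m) ℚ.* (ι x ℚ.* recip y)) (sym (trans g≡w (w-∣ _ 3∣))) d≡ ⟩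
        evenR m ℚ.+ sgn (suc m) ℚ.* (ι (g h (suc (dbl 0 m))) ℚ.* recip (suc (dbl 0 m))) ∎
      where
      open ≡-Reasoning
      A = sumBelow m evenTerm
      B = sumBelow m evenTerm₃
      r = recip (2 ℕ.* m ℕ.+ 1)
      d≡ = 2m+1≡ m
      g≡w = g-∸ d<p d≡
    ... | no 3∤ = begin
        _ ≡⟨ solve 5 (λ z A B s r → z :- con (+ 2 / 1) :* (A :+ s :* r) :+ con (+ 3 / 1) :* (B :+ s :* r)
               := z :- con (+ 2 / 1) :* A :+ con (+ 3 / 1) :* B :+ :- s :* (con (ι (- + 1)) :* r)) refl (ι z ℚ.* rp) A B (sgn m) r ⟩
        evenR m ℚ.+ sgn (suc m) ℚ.* (ι (- + 1) ℚ.* r) ≡⟨ cong₂ (λ x y → evenR m ℚ.+ sgn (suc m) ℚ.* (ι x ℚ.* recip y)) (sym (trans g≡w (w-∤ _ 3∤))) d≡ ⟩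
        evenR m ℚ.+ sgn (suc m) ℚ.* (ι (g h (suc (dbl 0 m))) ℚ.* recip (suc (dbl 0 m))) ∎
      where
      open ≡-Reasoning
      A = sumBelow m evenTerm
      B = sumBelow m evenTerm₃
      r = recip (2 ℕ.* m ℕ.+ 1)
      d≡ = 2m+1≡ m
      g≡w = g-∸ d<p d≡

    even-≈ : + p * + p ∣ T p 0 - sg h - z → ∀ m → dbl 0 m < p → evenL m ≈ evenR m
    even-≈ base zero _ = congruent (subst Integral (begin
        (ι (T p 0 - sg h - z) ℚ.* rp ℚ.- 0ℚ) ℚ.* rp
          ≡⟨ cong (λ x → (x ℚ.* rp ℚ.- 0ℚ) ℚ.* rp) (trans (ι-sub (T p 0 - sg h) z) (cong (ℚ._- ι z) (trans (ι-sub (T p 0) (sg h)) (cong (λ x → ι (T p 0) ℚ.- x) (ι-sg h))))) ⟩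
        ((ι (T p 0) ℚ.- sgn h ℚ.- ι z) ℚ.* rp ℚ.- 0ℚ) ℚ.* rp
          ≡⟨ solve 4 (λ T s z r → ((T :- s :- z) :* r :- con 0ℚ) :* r
               := ((con 1ℚ :* T :- s) :* r :- (z :* r :- con (+ 2 / 1) :* con 0ℚ :+ con (+ 3 / 1) :* con 0ℚ)) :* r) refl (ι (T p 0)) (sgn h) (ι z) rp ⟩
        (evenL 0 ℚ.- evenR 0) ℚ.* rp ∎) (quotient-integral (mod²⇒≈0 base)))
      where open ≡-Reasoning
    even-≈ base (suc m) d<p = subst₂ _≈_
        (sym (trans (cong (λ x → (sgn (suc m) ℚ.* x ℚ.- sgn h) ℚ.* rp) (ι-T-recurrence d))
          (solve 5 (λ s x y e r → (:- s :* (x :- y) :- e) :* r := (s :* y :- e) :* r :+ :- s :* (x :* r)) refl (sgn m) (ι (t p (+ suc d))) (ι (T p d)) (sgn h) rp)))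
        (sym (evenR-suc m d+1<p))
        (≈-affine (sgn (suc m)) (Integral-sgn (suc m)) (even-≈ base m (ℕₚ.<-trans (ℕₚ.n<1+n d) d+1<p)) (t-≈ d d+1<p))
      where
      d = dbl 0 m
      d+1<p : suc d < p
      d+1<p = ℕₚ.<-trans (ℕₚ.n<1+n (suc d)) d<p

-- Assembly for a prime p > 3

parity : ∀ n → ∃ λ h → n ≡ dbl 0 h ⊎ n ≡ suc (dbl 0 h)
parity zero = zero , inj₁ refl
parity (suc n) with parity n
... | h , inj₁ n≡ = h , inj₂ (cong suc n≡)
... | h , inj₂ n≡ = suc h , inj₁ (cong suc n≡)

odd-prime : ∀ {p} → Prime p → 3 < p → ∃ λ h → p ≡ suc (dbl 0 h)
odd-prime {p} pp 3<p with parity p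
... | h , inj₂ p≡ = h , p≡
... | h , inj₁ p≡ with prime⇒irreducible pp {2} (ℕ∣.divides h (trans p≡ (dbl≡*2 h)))
... | inj₂ 2≡p = ⊥-elim (ℕₚ.<-asym 3<p (subst (_< 3) 2≡p (ℕₚ.n<1+n 2)))

theorem1p1 : (p : ℕ) → Prime p → 3 < p → (d : ℕ) → d < p →
    ((m : ℕ) → d ≡ 2 ℕ.* m ℕ.+ 1 →
    (sumRange 0 (p ∸ 1) (λ k → ((+ trinom k (+ d)) / 1)) ℚ.* recip p)
    ≡ (sgn (m ℕ.+ 1) ℚ.* (+ 1 / 2)) ℚ.*
    (sumRange 1 m (λ k → sgn k ℚ.* recip k)
    ℚ.- ((+ 3) / 1) ℚ.* sumRange 1 m (λ k →
    if ⌊ 3 ∣? (k ℕ.+ p) ⌋ then sgn k ℚ.* recip k else 0ℚ))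
    [modℚ p ])
    × ((m : ℕ) → d ≡ 2 ℕ.* m →
    ((sgn m ℚ.* sumRange 0 (p ∸ 1) (λ k → ((+ trinom k (+ d)) / 1))
    ℚ.- sgn ((p ∸ 1) ℕ./ 2)) ℚ.* recip p)
    ≡ ((+ 3 ℤ.* legendre (ℤ.- (+ 2)) p
    ℤ.* S (∣ + p ℤ.- legendre (+ 3) p ∣ ℕ./ 2)) / 1) ℚ.* recip p
    ℚ.- ((+ 2) / 1) ℚ.* sumBelow m (λ j → sgn j ℚ.* recip (2 ℕ.* j ℕ.+ 1))
    ℚ.+ ((+ 3) / 1) ℚ.* sumBelow m (λ j →
    if not ⌊ 3 ∣? (p ∸ (2 ℕ.* j ℕ.+ 1)) ⌋ then sgn j ℚ.* recip (2 ℕ.* j ℕ.+ 1) else 0ℚ)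
    [modℚ p ])
theorem1p1 p pp 3<p d d<p with odd-prime pp 3<p
... | h , refl =
    (λ { m refl → p∤↧ (quotient-integral (subst₂ _≈_
          (cong (ℚ._* rp) (trans (cong (λ e → ι (T p e)) (sym (2m+1≡ m))) (sym (sumRange-T (2 ℕ.* m ℕ.+ 1)))))
          (cong₂ ℚ._*_ (cong (λ k → sgn k ℚ.* (+ 1 / 2)) (ℕₚ.+-comm 1 m))
            (cong₂ (λ x y → x ℚ.- (+ 3 / 1) ℚ.* y) (sym (sumRange-sumBelow 1 m _)) (sym (sumRange-sumBelow 1 m _))))
          (odd-≈ m (subst (_< p) (2m+1≡ m) d<p)))) })
  , (λ { m refl → p∤↧ (quotient-integral (subst (_≈ evenR z m)
          (cong₂ (λ x y → (sgn m ℚ.* x ℚ.- sgn y) ℚ.* rp)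
            -- `index (+ 1)` evaluates to (p - 1)/2, the exponent of the sign in the statement.
            (trans (cong (λ e → ι (T p e)) (sym (2m≡ m))) (sym (sumRange-T (2 ℕ.* m)))) (sym index-1))
          (even-≈ z (proj₂ T-mod²) m (subst (_< p) (2m≡ m) d<p)))) })
  where
  open OddPrime h pp 3<p using (rp; 2m+1≡; odd-≈; even-≈; evenR; index; index-1; T-mod²)
  open Integral pp
  z = + 3 * legendre (- + 2) p * S (index (legendre (+ 3) p))
  2m≡ : ∀ m → 2 ℕ.* m ≡ dbl 0 m
  2m≡ m = trans (ℕₚ.*-comm 2 m) (sym (dbl≡*2 m))
  sumRange-T : ∀ e → sumRange 0 (p ∸ 1) (λ k → ((+ trinom k (+ e)) / 1)) ≡ ι (T p e)
  sumRange-T e = trans (sumRange-sumBelow 0 (p ∸ 1) _) (ι-sum p (λ k → t k (+ e)))
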